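{- For every integer $r\ge 3$ there exists a family $\mathcal{F}$ of four $r$-graphs such that $\frac{\operatorname{sat}(\mathcal{F},n)}{n^{r-1}}$ does not converge as $n\to\infty$.
   Context: An $r$-graph $H$ is a pair $(V(H),E(H))$ where $V(H)$ is a finite set of vertices and the edge set $E(H)$ is a collection of $r$-element subsets of $V(H)$. Write $|H|=|V(H)|$ and $e(H)=|E(H)|$. Containment of one $r$-graph in another as a subgraph means containing a (not necessarily induced) copy of it. For a family $\mathcal{F}$ of $r$-graphs, an $r$-graph $H$ is called $\mathcal{F}$-saturated if it does not contain any graph in $\mathcal{F}$ as a subgraph, but adding any extra edge (that is, any $r$-element subset of $V(H)$ not in $E(H)$) to $H$ creates a copy of some graph $F\in\mathcal{F}$ as a subgraph. The saturation number is $$\operatorname{sat}(\mathcal{F},n)=\min\{e(H): |H|=n \text{ and } H \text{ is } \mathcal{F}\text{ -saturated}\}.$$ -}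

module Defs where

open import Data.Bool.Base using (true; false)
open import Data.Fin.Base using (Fin; zero; suc)
open import Data.Fin.Subset using (Subset; ⊥; ⁅_⁆; _∪_; ∣_∣)
open import Data.List.Base using (List; _∷_; length)
open import Data.List.Membership.Propositional using (_∈_; _∉_)
open import Data.List.Relation.Unary.All as All using (All)
open import Data.List.Relation.Unary.All.Properties using (¬Any⇒All¬)
open import Data.List.Relation.Unary.AllPairs as AllPairs using ()
open import Data.List.Relation.Unary.Unique.Propositional using (Unique)
open import Data.Integer.Base using (+_)
open import Data.Nat.Base as ℕ using (ℕ; zero; suc; NonZero; _^_)
open import Data.Nat.Properties using (m^n≢0)
open import Data.Product.Base using (Σ-syntax; ∃; ∃-syntax; _×_; _,_; proj₁; proj₂)
open import Data.Rational.Base as ℚ using (ℚ; 0ℚ)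
open import Data.Sum.Base using (_⊎_)
open import Data.Vec.Base using ([]; _∷_)
open import Function.Base using (_∘_)
open import Function.Bundles using (_↔_; _⇔_; _↣_; Injection; Inverse)
open import Relation.Binary.PropositionalEquality using (_≡_; _≢_)
open import Relation.Nullary.Negation using (¬_)

-- The edge set is a duplicate-free list; only membership and length are used,
-- so the order of the list is immaterial.
record RGraph (r n : ℕ) : Set where
  constructor mkRGraph
  field
    edges   : List (Subset n)
    uniform : All (λ e → ∣ e ∣ ≡ r) edges
    unique  : Unique edges

open RGraph public

e[_] : ∀ {r n} → RGraph r n → ℕ
e[ H ] = length (edges H)

addEdge : ∀ {r n} (H : RGraph r n) (e : Subset n) → ∣ e ∣ ≡ r → e ∉ edges H → RGraph r n
addEdge H e ∣e∣≡r e∉H = mkRGraph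
  (e ∷ edges H)
  (∣e∣≡r All.∷ uniform H)
  (¬Any⇒All¬ (edges H) e∉H AllPairs.∷ unique H)

image : ∀ {m n} → (Fin m → Fin n) → Subset m → Subset n
image f []          = ⊥
image f (true  ∷ p) = ⁅ f zero ⁆ ∪ image (f ∘ suc) p
image f (false ∷ p) = image (f ∘ suc) p

infix 4 _⊑_ _≅_

-- H contains a (not necessarily induced) copy of F.
_⊑_ : ∀ {r m n} → RGraph r m → RGraph r n → Set
_⊑_ {m = m} {n} F H =
  Σ[ f ∈ Fin m ↣ Fin n ] (∀ e → e ∈ edges F → image (Injection.to f) e ∈ edges H)

_≅_ : ∀ {r m n} → RGraph r m → RGraph r n → Set
_≅_ {m = m} {n} F G =
  Σ[ f ∈ Fin m ↔ Fin n ] (∀ e → e ∈ edges F ⇔ image (Inverse.to f) e ∈ edges G)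

Family : (r k : ℕ) → Set
Family r k = Fin k → ∃ (RGraph r)

PairwiseNonIsomorphic : ∀ {r k} → Family r k → Set
PairwiseNonIsomorphic 𝓕 = ∀ i j → i ≢ j → ¬ (proj₂ (𝓕 i) ≅ proj₂ (𝓕 j))

Saturated : ∀ {r k n} → Family r k → RGraph r n → Set
Saturated {r} 𝓕 H =
  (∀ i → ¬ (proj₂ (𝓕 i) ⊑ H)) ×
  (∀ e (∣e∣≡r : ∣ e ∣ ≡ r) (e∉H : e ∉ edges H) →
     ∃[ i ] proj₂ (𝓕 i) ⊑ addEdge H e ∣e∣≡r e∉H)

-- sat(𝓕, n) = m.  A relation, because the minimum is over an empty set for
-- some families (for example when a member of 𝓕 has no edges).
IsSat : ∀ {r k} → Family r k → (n m : ℕ) → Set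
IsSat {r} 𝓕 n m =
  (Σ[ H ∈ RGraph r n ] (Saturated 𝓕 H × e[ H ] ≡ m)) ×
  (∀ (H : RGraph r n) → Saturated 𝓕 H → m ℕ.≤ e[ H ])

-- Dedekind reals: two-sided rounded, disjoint, located cuts.
record ℝ : Set₁ where
  field
    Lower Upper     : ℚ → Set
    lower-inhabited : ∃ Lower
    upper-inhabited : ∃ Upper
    lower-rounded   : ∀ p → Lower p ⇔ (∃[ q ] (p ℚ.< q × Lower q))
    upper-rounded   : ∀ q → Upper q ⇔ (∃[ p ] (p ℚ.< q × Upper p))
    disjoint        : ∀ q → ¬ (Lower q × Upper q)
    located         : ∀ p q → p ℚ.< q → Lower p ⊎ Upper q

-- Sequences are indexed by the positive integers.
Sequence : Set
Sequence = (n : ℕ) → .{{_ : NonZero n}} → ℚ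

-- ∣ aₙ - x ∣ < ε is written as aₙ - ε < x < aₙ + ε.
_ConvergesTo_ : Sequence → ℝ → Set
a ConvergesTo x =
  ∀ ε → 0ℚ ℚ.< ε →
  ∃[ N ] (∀ n .{{_ : NonZero n}} → N ℕ.≤ n →
    ℝ.Lower x (a n ℚ.- ε) × ℝ.Upper x (a n ℚ.+ ε))

Converges : Sequence → Set₁
Converges a = ∃[ x ] (a ConvergesTo x)

_/n^_ : (ℕ → ℕ) → ℕ → Sequence
(s /n^ d) n = ℚ._/_ (+ s n) (n ^ d) {{m^n≢0 n d}}

{-# OPTIONS --safe #-}
module Submission where

-- Write r = 3 + q. Four r-graphs are chosen, all of them unions of cliques (complete
-- r-graphs), with two large orders p and m = p + q:
--   (0) an edge meeting a clique of order p in exactly two vertices;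
--   (1) a clique of order p with 2 + q extra vertices, each of which spans a clique
--       with the same r vertices of it (a sunflower);
--   (2) two cliques of order p sharing exactly one vertex;
--   (3) an edge with a clique of order m attached at each of its vertices, these r
--       cliques being disjoint (a spider).
--
-- If m divides n, the disjoint union of n / m cliques of order m is saturated
-- (U-saturated): each forbidden graph is connected with more than m vertices, so none
-- is contained in it; a new edge with two vertices in one block and another one
-- outside that block creates (0), by leavingEdge, and a new edge meeting each block
-- at most once creates (3). It has only O(n) edges, so sat(n) / n^(r-1) is
-- arbitrarily small for these n, as r is at least 3.
--
-- If m does not divide n, every saturated graph H has at least c n^(r-1) edges for
-- some c > 0 (manyEdges). As (0) and (2) are excluded, the m-cliques of H are
-- disjoint (K-m-disjoint), so some vertex v lies in none of them. Call two vertices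
-- related if they lie in a common p-clique. Excluding (0) and (2) makes p-cliques
-- through a common vertex overlap in all but q vertices (K-p-overlap), and excluding
-- (1) then bounds the number of vertices related to a given one (outside≤). Let T be
-- a set of r - 1 vertices such that no two of the vertices in T and v are related.
-- Then T is contained in an edge of H (covered). Otherwise adding the edge e = T + v
-- creates a forbidden graph, but e lies in no clique of order r + 1 of H + e, as T is
-- not contained in an edge of H; so e is the edge in (0), and two of its vertices are
-- related, or it is the edge in (3), and v lies in an m-clique of H. Both are
-- impossible (addedEdge-free). A greedy choice gives linearly many pairwise unrelated
-- vertices, also unrelated to v, all of whose (r - 1)-subsets are covered by edges
-- (independent), and each edge covers boundedly many of them (coverBound).
--
-- Hence sat(n) / n^(r-1) oscillates. That sat(n) is defined for all n follows from a
-- greedy construction of a saturated graph, and it is computed by a finite search.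

open import Defs
open import Data.Nat.Base using (ℕ; _≤_; _∸_)
open import Data.Product.Base using (Σ-syntax; _×_)
open import Relation.Nullary.Negation using (¬_)

open import Data.Bool.Base using (true; false)
open import Data.Bool.Properties as Boolₚ using ()
open import Data.Empty as Empty using (⊥-elim)
open import Data.Fin.Base as Fin using (Fin; zero; suc; _↑ˡ_; _↑ʳ_; splitAt; join; combine; remQuot; quotient; remainder; finToFun; funToFin)
open import Data.Fin.Patterns using (0F; 1F; 2F; 3F)
open import Data.Fin.Permutation using (↔⇒≡)
open import Data.Fin.Properties as Finₚ using (any?; all?; suc-injective; 0≢1+n; finToFun-funToFin; funToFin-finToFin; injective⇒≤; ¬∀⟶∃¬; ↑ˡ-injective; ↑ʳ-injective; splitAt-↑ˡ; splitAt-↑ʳ; join-splitAt; combine-injective; combine-injectiveˡ; combine-injectiveʳ; combine-surjective; remQuot-combine; combine-remQuot)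
open import Data.Fin.Subset
open import Data.Fin.Subset.Properties
open import Data.Integer.Base as ℤ using (+_)
import Data.Integer.Properties as ℤₚ
open import Data.List.Base as List using (List; []; _∷_; length; filter)
import Data.List.Membership.DecPropositional as DecMembership
open import Data.List.Membership.Propositional using (lose; find) renaming (_∈_ to _∈ₗ_; _∉_ to _∉ₗ_)
open import Data.List.Membership.Propositional.Properties using (∈-map⁺; ∈-map⁻; ∈-++⁺ˡ; ∈-++⁺ʳ; ∈-filter⁺; ∈-filter⁻; ∈-lookup; ∈-allFin; ∈-cartesianProductWith⁺)
open import Data.List.Properties using (length-++; length-map; length-tabulate)
open import Data.List.Relation.Unary.All as All using (All)
open import Data.List.Relation.Unary.AllPairs as AllPairs using ()
open import Data.List.Relation.Unary.Any as Any using (Any; here; there)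
open import Data.List.Relation.Unary.Any.Properties using (lookup-index)
open import Data.List.Relation.Unary.Unique.DecPropositional using (unique?)
open import Data.List.Relation.Unary.Unique.Propositional using (Unique)
import Data.List.Relation.Unary.Unique.Propositional.Properties as Uniqueₚ
open import Data.Nat.Base as ℕ using (zero; suc; _+_; _*_; _^_; _<_; z≤n; s≤s; NonZero)
open import Data.Nat.Divisibility using (_∣_; _∣0; ∣m∣n⇒∣m+n; ∣m+n∣m⇒∣n; ∣-refl; n∣m*n; ∣1⇒≡1)
open import Data.Nat.Properties as ℕₚ using (≤-trans; ≤-refl; ≤-reflexive)
open import Data.Nat.Solver using (module +-*-Solver)
open import Data.Product.Base using (∃; ∃-syntax; _,_; proj₁; proj₂; uncurry)
open import Data.Rational.Base as ℚ using (ℚ; 0ℚ)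
import Data.Rational.Properties as ℚₚ
open import Data.Rational.Unnormalised.Base using (mkℚᵘ; *≤*; *≡*)
import Data.Rational.Unnormalised.Properties as ℚᵘₚ
open import Data.Sum.Base using (_⊎_; inj₁; inj₂; [_,_]′)
open import Data.Vec.Base using ([]; _∷_; here; there; tabulate; lookup)
open import Data.Vec.Properties using ([]=⇒lookup; lookup⇒[]=; lookup∘tabulate; ≡-dec; ∷-injectiveʳ)
open import Function.Base using (_∘_; id)
open import Function.Bundles using (Equivalence; Injection; mk↣)
open import Relation.Binary.Definitions using (tri<; tri≈; tri>)
open import Relation.Binary.PropositionalEquality using (_≡_; _≢_; refl; sym; trans; cong; cong₂; subst; subst₂)
open import Relation.Nullary using (Dec; yes; no; does; contradiction)
open import Relation.Nullary.Decidable using (_×-dec_; _→-dec_; ¬?; map′; decidable-stable; dec-true)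

private variable
  l n : ℕ

-- Finite sets

-- Injectivity with both arguments implicit.
Inj : ∀ {A B : Set} → (A → B) → Set
Inj f = ∀ {x y} → f x ≡ f y → x ≡ y

∈-image⁺ : ∀ (f : Fin l → Fin n) s {x} → x ∈ s → f x ∈ image f s
∈-image⁺ f (true ∷ s)  here        = p⊆p∪q _ (x∈⁅x⁆ _)
∈-image⁺ f (true ∷ s)  (there x∈s) = q⊆p∪q ⁅ f zero ⁆ _ (∈-image⁺ (f ∘ suc) s x∈s)
∈-image⁺ f (false ∷ s) (there x∈s) = ∈-image⁺ (f ∘ suc) s x∈s

∈-image⁻ : ∀ (f : Fin l → Fin n) s {y} → y ∈ image f s → ∃[ x ] (x ∈ s × f x ≡ y)
∈-image⁻ f []          y∈ = ⊥-elim (∉⊥ y∈)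
∈-image⁻ f (true ∷ s)  y∈ with x∈p∪q⁻ ⁅ f zero ⁆ (image (f ∘ suc) s) y∈
... | inj₁ y∈₁ = zero , here , sym (x∈⁅y⁆⇒x≡y _ y∈₁)
... | inj₂ y∈₂ with x , x∈s , fx≡y ← ∈-image⁻ (f ∘ suc) s y∈₂ = suc x , there x∈s , fx≡y
∈-image⁻ f (false ∷ s) y∈ with x , x∈s , fx≡y ← ∈-image⁻ (f ∘ suc) s y∈ = suc x , there x∈s , fx≡y

-- The set of values of f.
range : (Fin l → Fin n) → Subset n
range f = image f ⊤

∈-range⁺ : ∀ (f : Fin l → Fin n) x → f x ∈ range f
∈-range⁺ f x = ∈-image⁺ f ⊤ ∈⊤

∈-range⁻ : ∀ (f : Fin l → Fin n) {y} → y ∈ range f → ∃[ x ] f x ≡ y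
∈-range⁻ f y∈ with x , _ , eq ← ∈-image⁻ f ⊤ y∈ = x , eq

range⊆ : ∀ (f : Fin l → Fin n) {X} → (∀ i → f i ∈ X) → range f ⊆ X
range⊆ f f∈ y∈ with i , refl ← ∈-range⁻ f y∈ = f∈ i

-- The set of all x with f x in s.
preimage : (Fin l → Fin n) → Subset n → Subset l
preimage f s = tabulate (lookup s ∘ f)

∈-preimage⁺ : ∀ (f : Fin l → Fin n) s {x} → f x ∈ s → x ∈ preimage f s
∈-preimage⁺ f s {x} fx∈s =
  lookup⇒[]= x _ (trans (lookup∘tabulate (lookup s ∘ f) x) ([]=⇒lookup fx∈s))

∈-preimage⁻ : ∀ (f : Fin l → Fin n) s {x} → x ∈ preimage f s → f x ∈ s
∈-preimage⁻ f s {x} x∈ =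
  lookup⇒[]= (f x) s (trans (sym (lookup∘tabulate (lookup s ∘ f) x)) ([]=⇒lookup x∈))

image-preimage : ∀ (f : Fin l → Fin n) {s} → s ⊆ range f → image f (preimage f s) ≡ s
image-preimage f {s} s⊆ = ⊆-antisym ⊆₁ ⊆₂
  where
  ⊆₁ : image f (preimage f s) ⊆ s
  ⊆₁ y∈ with x , x∈ , refl ← ∈-image⁻ f (preimage f s) y∈ = ∈-preimage⁻ f s x∈
  ⊆₂ : s ⊆ image f (preimage f s)
  ⊆₂ y∈ with x , refl ← ∈-range⁻ f (s⊆ y∈) = ∈-image⁺ f (preimage f s) (∈-preimage⁺ f s y∈)

x∈p─q⇒x∉q : ∀ (p q : Subset n) {x} → x ∈ p ─ q → x ∉ q
x∈p─q⇒x∉q (_ ∷ p)    (false ∷ q) (there x∈) (there x∈q) = x∈p─q⇒x∉q p q x∈ x∈q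
x∈p─q⇒x∉q (_ ∷ p)    (true ∷ q)  (there x∈) (there x∈q) = x∈p─q⇒x∉q p q x∈ x∈q

∣p∩q∣+∣p─q∣≡∣p∣ : ∀ (p q : Subset n) → ∣ p ∩ q ∣ + ∣ p ─ q ∣ ≡ ∣ p ∣
∣p∩q∣+∣p─q∣≡∣p∣ [] [] = refl
∣p∩q∣+∣p─q∣≡∣p∣ (true ∷ p)  (true ∷ q)  = cong suc (∣p∩q∣+∣p─q∣≡∣p∣ p q)
∣p∩q∣+∣p─q∣≡∣p∣ (true ∷ p)  (false ∷ q) =
  trans (ℕₚ.+-suc _ _) (cong suc (∣p∩q∣+∣p─q∣≡∣p∣ p q))
∣p∩q∣+∣p─q∣≡∣p∣ (false ∷ p) (true ∷ q)  = ∣p∩q∣+∣p─q∣≡∣p∣ p q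
∣p∩q∣+∣p─q∣≡∣p∣ (false ∷ p) (false ∷ q) = ∣p∩q∣+∣p─q∣≡∣p∣ p q

Disjoint : Subset n → Subset n → Set
Disjoint p q = ∀ {x} → x ∈ p → x ∉ q

∣p∪q∣≡∣p∣+∣q∣ : ∀ (p q : Subset n) → Disjoint p q → ∣ p ∪ q ∣ ≡ ∣ p ∣ + ∣ q ∣
∣p∪q∣≡∣p∣+∣q∣ [] [] _ = refl
∣p∪q∣≡∣p∣+∣q∣ (true ∷ p)  (true ∷ q)  dis = contradiction here (dis here)
∣p∪q∣≡∣p∣+∣q∣ (true ∷ p)  (false ∷ q) dis =
  cong suc (∣p∪q∣≡∣p∣+∣q∣ p q (λ x∈p x∈q → dis (there x∈p) (there x∈q)))
∣p∪q∣≡∣p∣+∣q∣ (false ∷ p) (true ∷ q)  dis =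
  trans (cong suc (∣p∪q∣≡∣p∣+∣q∣ p q (λ x∈p x∈q → dis (there x∈p) (there x∈q)))) (sym (ℕₚ.+-suc _ _))
∣p∪q∣≡∣p∣+∣q∣ (false ∷ p) (false ∷ q) dis =
  ∣p∪q∣≡∣p∣+∣q∣ p q (λ x∈p x∈q → dis (there x∈p) (there x∈q))

∣p∪q∣≤∣p∣+∣q∣ : ∀ (p q : Subset n) → ∣ p ∪ q ∣ ≤ ∣ p ∣ + ∣ q ∣
∣p∪q∣≤∣p∣+∣q∣ [] [] = z≤n
∣p∪q∣≤∣p∣+∣q∣ (true ∷ p)  (true ∷ q)  =
  s≤s (≤-trans (∣p∪q∣≤∣p∣+∣q∣ p q) (ℕₚ.+-monoʳ-≤ ∣ p ∣ (ℕₚ.n≤1+n _)))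
∣p∪q∣≤∣p∣+∣q∣ (true ∷ p)  (false ∷ q) = s≤s (∣p∪q∣≤∣p∣+∣q∣ p q)
∣p∪q∣≤∣p∣+∣q∣ (false ∷ p) (true ∷ q)  =
  ≤-trans (s≤s (∣p∪q∣≤∣p∣+∣q∣ p q)) (≤-reflexive (sym (ℕₚ.+-suc _ _)))
∣p∪q∣≤∣p∣+∣q∣ (false ∷ p) (false ∷ q) = ∣p∪q∣≤∣p∣+∣q∣ p q

∣image∣ : ∀ {f : Fin l → Fin n} → Inj f → ∀ s → ∣ image f s ∣ ≡ ∣ s ∣
∣image∣ {n = n} inj [] = ∣⊥∣≡0 n
∣image∣ {f = f} inj (true ∷ s) = trans
  (∣p∪q∣≡∣p∣+∣q∣ ⁅ f zero ⁆ (image (f ∘ suc) s) dis)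
  (cong₂ _+_ (∣⁅x⁆∣≡1 (f zero)) (∣image∣ (suc-injective ∘ inj) s))
  where
  dis : Disjoint ⁅ f zero ⁆ (image (f ∘ suc) s)
  dis x∈ y∈ with refl ← x∈⁅y⁆⇒x≡y _ x∈ | z , _ , eq ← ∈-image⁻ (f ∘ suc) s y∈ = 0≢1+n (inj (sym eq))
∣image∣ inj (false ∷ s) = ∣image∣ (suc-injective ∘ inj) s

∣range∣ : ∀ {f : Fin l → Fin n} → Inj f → ∣ range f ∣ ≡ l
∣range∣ inj = trans (∣image∣ inj ⊤) (∣⊤∣≡n _)

⊆∧∣≥∣⇒≡ : ∀ {p q : Subset n} → p ⊆ q → ∣ q ∣ ≤ ∣ p ∣ → p ≡ q
⊆∧∣≥∣⇒≡ {p = []} {[]} _ _ = refl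
⊆∧∣≥∣⇒≡ {p = true ∷ p}  {true ∷ q}  p⊆q (s≤s le) = cong (true ∷_) (⊆∧∣≥∣⇒≡ (drop-∷-⊆ p⊆q) le)
⊆∧∣≥∣⇒≡ {p = true ∷ p}  {false ∷ q} p⊆q le with () ← p⊆q here
⊆∧∣≥∣⇒≡ {p = false ∷ p} {true ∷ q}  p⊆q le =
  contradiction (≤-trans le (p⊆q⇒∣p∣≤∣q∣ (drop-∷-⊆ p⊆q))) ℕₚ.1+n≰n
⊆∧∣≥∣⇒≡ {p = false ∷ p} {false ∷ q} p⊆q le = cong (false ∷_) (⊆∧∣≥∣⇒≡ (drop-∷-⊆ p⊆q) le)

⊆⊎⊈ : ∀ (p q : Subset n) → (p ⊆ q) ⊎ (∃[ x ] (x ∈ p × x ∉ q))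
⊆⊎⊈ [] [] = inj₁ id
⊆⊎⊈ (s ∷ p) (t ∷ q) with ⊆⊎⊈ p q
... | inj₂ (x , x∈p , x∉q) = inj₂ (suc x , there x∈p , x∉q ∘ drop-there)
⊆⊎⊈ (true ∷ p) (false ∷ q) | inj₁ _ = inj₂ (zero , here , λ ())
⊆⊎⊈ (true ∷ p) (true ∷ q)  | inj₁ p⊆q = inj₁ (s⊆s p⊆q)
⊆⊎⊈ (false ∷ p) (t ∷ q)    | inj₁ p⊆q = inj₁ (out⊆ p⊆q)

-- Every size between those of two nested sets occurs between them.
interpolate : ∀ {X Y : Subset n} → X ⊆ Y → ∀ {a} → ∣ X ∣ ≤ a → a ≤ ∣ Y ∣ →
              ∃[ Z ] (X ⊆ Z × Z ⊆ Y × ∣ Z ∣ ≡ a)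
interpolate {X = []} {[]} _ {zero} _ _ = [] , id , id , refl
interpolate {X = true ∷ X} {false ∷ Y} X⊆Y _ _ with () ← X⊆Y here
interpolate {X = true ∷ X} {true ∷ Y} X⊆Y {suc a} (s≤s l) (s≤s u)
  with Z , X⊆Z , Z⊆Y , eq ← interpolate (drop-∷-⊆ X⊆Y) l u =
  true ∷ Z , s⊆s X⊆Z , s⊆s Z⊆Y , cong suc eq
interpolate {X = false ∷ X} {false ∷ Y} X⊆Y l u
  with Z , X⊆Z , Z⊆Y , eq ← interpolate (drop-∷-⊆ X⊆Y) l u =
  false ∷ Z , s⊆s X⊆Z , s⊆s Z⊆Y , eq
interpolate {X = false ∷ X} {true ∷ Y} X⊆Y {a} l u with a ℕₚ.≤? ∣ Y ∣
... | yes a≤ with Z , X⊆Z , Z⊆Y , eq ← interpolate (drop-∷-⊆ X⊆Y) l a≤ =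
  false ∷ Z , s⊆s X⊆Z , out⊆ Z⊆Y , eq
... | no a≰ = true ∷ Y , X⊆Y , id , ℕₚ.≤-antisym (ℕₚ.≰⇒> a≰) u

-- An enumeration of X by Fin a, without repetition.
record Enum (X : Subset n) (a : ℕ) : Set where
  field
    to   : Fin a → Fin n
    inj  : Inj to
    to∈  : ∀ i → to i ∈ X
    onto : ∀ {x} → x ∈ X → ∃[ i ] to i ≡ x

enum : ∀ (X : Subset n) {a} → ∣ X ∣ ≡ a → Enum X a
enum [] refl = record { to = λ () ; inj = λ { {()} } ; to∈ = λ () ; onto = λ () }
enum {suc n} (true ∷ X) refl = record { to = to′ ; inj = inj′ ; to∈ = to∈′ ; onto = onto′ }
  where
  open Enum (enum X refl)
  to′ : Fin (suc ∣ X ∣) → Fin (suc n)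
  to′ zero    = zero
  to′ (suc i) = suc (to i)
  inj′ : Inj to′
  inj′ {zero}  {zero}  _  = refl
  inj′ {suc i} {suc j} eq = cong suc (inj (suc-injective eq))
  to∈′ : ∀ i → to′ i ∈ true ∷ X
  to∈′ zero    = here
  to∈′ (suc i) = there (to∈ i)
  onto′ : ∀ {x} → x ∈ true ∷ X → ∃[ i ] to′ i ≡ x
  onto′ here       = zero , refl
  onto′ (there x∈) with i , eq ← onto x∈ = suc i , cong suc eq
enum {suc n} (false ∷ X) refl = record
  { to   = suc ∘ to
  ; inj  = inj ∘ suc-injective
  ; to∈  = λ i → there (to∈ i)
  ; onto = λ { (there x∈) → let i , eq = onto x∈ in i , cong suc eq }
  }
  where open Enum (enum X refl)

nonempty : ∀ {X : Subset n} → 1 ≤ ∣ X ∣ → ∃[ x ] x ∈ X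
nonempty {X = X} 1≤ with ∣ X ∣ in eq
... | suc a = _ , Enum.to∈ (enum X eq) zero

twoElements : ∀ {X : Subset n} → 2 ≤ ∣ X ∣ → ∃[ x ] ∃[ y ] (x ∈ X × y ∈ X × x ≢ y)
twoElements {X = X} 2≤ with ∣ X ∣ in eq
twoElements {X = X} (s≤s (s≤s _)) | suc (suc a) =
  _ , _ , to∈ zero , to∈ (suc zero) , λ eq′ → 0≢1+n (inj eq′)
  where open Enum (enum X eq)

pair : Fin n → Fin n → Subset n
pair x y = ⁅ x ⁆ ∪ ⁅ y ⁆

pair⊆ : ∀ {x y} {X : Subset n} → x ∈ X → y ∈ X → pair x y ⊆ X
pair⊆ x∈X y∈X z∈ with x∈p∪q⁻ _ _ z∈
... | inj₁ z∈₁ with refl ← x∈⁅y⁆⇒x≡y _ z∈₁ = x∈X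
... | inj₂ z∈₂ with refl ← x∈⁅y⁆⇒x≡y _ z∈₂ = y∈X

x∈pair : ∀ (x y : Fin n) → x ∈ pair x y
x∈pair x y = p⊆p∪q _ (x∈⁅x⁆ x)

y∈pair : ∀ (x y : Fin n) → y ∈ pair x y
y∈pair x y = q⊆p∪q ⁅ x ⁆ _ (x∈⁅x⁆ y)

∣pair∣≤2 : ∀ (x y : Fin n) → ∣ pair x y ∣ ≤ 2
∣pair∣≤2 x y = ≤-trans (∣p∪q∣≤∣p∣+∣q∣ ⁅ x ⁆ ⁅ y ⁆)
  (≤-reflexive (cong₂ _+_ (∣⁅x⁆∣≡1 x) (∣⁅x⁆∣≡1 y)))

∣pair∣≡2 : ∀ {x y : Fin n} → x ≢ y → ∣ pair x y ∣ ≡ 2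
∣pair∣≡2 {x = x} {y} x≢y = trans
  (∣p∪q∣≡∣p∣+∣q∣ ⁅ x ⁆ ⁅ y ⁆ (λ z∈x z∈y → x≢y (trans (sym (x∈⁅y⁆⇒x≡y x z∈x)) (x∈⁅y⁆⇒x≡y y z∈y))))
  (cong₂ _+_ (∣⁅x⁆∣≡1 x) (∣⁅x⁆∣≡1 y))

insert : Fin n → Subset n → Subset n
insert x X = ⁅ x ⁆ ∪ X

∣insert∣ : ∀ {x} {X : Subset n} → x ∉ X → ∣ insert x X ∣ ≡ suc ∣ X ∣
∣insert∣ {x = x} {X} x∉X = trans
  (∣p∪q∣≡∣p∣+∣q∣ ⁅ x ⁆ X (λ z∈ → subst (_∉ X) (sym (x∈⁅y⁆⇒x≡y x z∈)) x∉X))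
  (cong (_+ ∣ X ∣) (∣⁅x⁆∣≡1 x))

x∈insert : ∀ (x : Fin n) X → x ∈ insert x X
x∈insert x X = p⊆p∪q X (x∈⁅x⁆ x)

⊆insert : ∀ (x : Fin n) X → X ⊆ insert x X
⊆insert x X = q⊆p∪q ⁅ x ⁆ X

∈-insert⁻ : ∀ {x y : Fin n} {X} → y ∈ insert x X → y ≡ x ⊎ y ∈ X
∈-insert⁻ {x = x} {X = X} y∈ with x∈p∪q⁻ ⁅ x ⁆ X y∈
... | inj₁ y∈₁ = inj₁ (x∈⁅y⁆⇒x≡y x y∈₁)
... | inj₂ y∈X = inj₂ y∈X

∣p-x∣ : ∀ {x : Fin n} {X} → x ∈ X → suc ∣ X - x ∣ ≡ ∣ X ∣
∣p-x∣ {x = x} {X} x∈X = trans (cong (_+ ∣ X - x ∣) (sym (trans (cong ∣_∣ X∩x≡x) (∣⁅x⁆∣≡1 x)))) (∣p∩q∣+∣p─q∣≡∣p∣ X ⁅ x ⁆)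
  where
  X∩x≡x : X ∩ ⁅ x ⁆ ≡ ⁅ x ⁆
  X∩x≡x = ⊆-antisym (p∩q⊆q X ⁅ x ⁆)
    (λ y∈ → x∈p∩q⁺ (subst (_∈ X) (sym (x∈⁅y⁆⇒x≡y x y∈)) x∈X , y∈))

image-cong : ∀ {f g : Fin l → Fin n} → (∀ x → f x ≡ g x) → ∀ s → image f s ≡ image g s
image-cong f≗g []          = refl
image-cong f≗g (true ∷ s)  = cong₂ (λ x t → ⁅ x ⁆ ∪ t) (f≗g zero) (image-cong (f≗g ∘ suc) s)
image-cong f≗g (false ∷ s) = image-cong (f≗g ∘ suc) s

subsetOfSize : ∀ (Y : Subset n) {a} → a ≤ ∣ Y ∣ → ∃[ Z ] (Z ⊆ Y × ∣ Z ∣ ≡ a)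
subsetOfSize {n} Y a≤ with Z , _ , Z⊆Y , ∣Z∣ ← interpolate {X = ⊥} {Y = Y} (λ x∈ → contradiction x∈ ∉⊥)
                             (≤-trans (≤-reflexive (∣⊥∣≡0 n)) z≤n) a≤ = Z , Z⊆Y , ∣Z∣

-- If each of t sets misses at most q elements of A, they share all but t q of them.
commonPart : ∀ {q} t (B : Fin t → Subset n) A → (∀ j → ∣ A ─ B j ∣ ≤ q) →
             ∃[ I ] (I ⊆ A × (∀ j → I ⊆ B j) × ∣ A ∣ ≤ ∣ I ∣ + t * q)
commonPart zero B A _ = A , id , (λ ()) , ℕₚ.m≤m+n _ _
commonPart {q = q} (suc t) B A miss
  with I , I⊆A , I⊆B , le ← commonPart t (B ∘ suc) A (miss ∘ suc) =
  I ∩ B zero , (λ x∈ → I⊆A (p∩q⊆p I _ x∈)) ,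
  (λ { zero → p∩q⊆q I (B zero) ; (suc j) x∈ → I⊆B j (p∩q⊆p I _ x∈) }) ,
  ≤-trans le (≤-trans (ℕₚ.+-monoˡ-≤ (t * q) step) (≤-reflexive (ℕₚ.+-assoc ∣ I ∩ B zero ∣ q (t * q))))
  where
  I─⊆ : I ─ B zero ⊆ A ─ B zero
  I─⊆ x∈ = x∈p∧x∉q⇒x∈p─q (I⊆A (p─q⊆p I _ x∈)) (x∈p─q⇒x∉q I (B zero) x∈)
  step : ∣ I ∣ ≤ ∣ I ∩ B zero ∣ + q
  step = ≤-trans (≤-reflexive (sym (∣p∩q∣+∣p─q∣≡∣p∣ I (B zero))))
    (ℕₚ.+-monoʳ-≤ ∣ I ∩ B zero ∣ (≤-trans (p⊆q⇒∣p∣≤∣q∣ I─⊆) (miss zero)))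

-- Maps on a sum of two finite sets

-- Case analysis on Fin (a + b).
elim-+ : ∀ a {b} (P : Fin (a + b) → Set) →
         (∀ i → P (i ↑ˡ b)) → (∀ j → P (a ↑ʳ j)) → ∀ x → P x
elim-+ a {b} P l r x = subst P (join-splitAt a b x) (go (splitAt a x))
  where
  go : ∀ s → P (join a b s)
  go (inj₁ i) = l i
  go (inj₂ j) = r j

↑ˡ≢↑ʳ : ∀ {k l} (i : Fin k) (j : Fin l) → i ↑ˡ l ≢ k ↑ʳ j
↑ˡ≢↑ʳ {k} {l} i j eq
  with () ← trans (sym (splitAt-↑ˡ k i l)) (trans (cong (splitAt k) eq) (splitAt-↑ʳ k l j))

infixr 5 _⊕_

-- Copairing: f on the first a elements of Fin (a + b) and g on the other b.
_⊕_ : ∀ {a b} {A : Set} → (Fin a → A) → (Fin b → A) → Fin (a + b) → A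
_⊕_ {a} f g x = [ f , g ]′ (splitAt a x)

module _ {a b} {A : Set} (f : Fin a → A) (g : Fin b → A) where

  ⊕-ˡ : ∀ i → (f ⊕ g) (i ↑ˡ b) ≡ f i
  ⊕-ˡ i = cong [ f , g ]′ (splitAt-↑ˡ a i b)

  ⊕-ʳ : ∀ j → (f ⊕ g) (a ↑ʳ j) ≡ g j
  ⊕-ʳ j = cong [ f , g ]′ (splitAt-↑ʳ a b j)

  ⊕-∈ : ∀ {P : A → Set} → (∀ i → P (f i)) → (∀ j → P (g j)) → ∀ x → P ((f ⊕ g) x)
  ⊕-∈ {P} Pf Pg x with splitAt a x
  ... | inj₁ i = Pf i
  ... | inj₂ j = Pg j

  ⊕-inj : Inj f → Inj g → (∀ i j → f i ≢ g j) → Inj (f ⊕ g)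
  ⊕-inj f-inj g-inj f≢g {x} {y} eq =
    trans (sym (join-splitAt a b x)) (trans (cong (join a b) (go (splitAt a x) (splitAt a y) eq)) (join-splitAt a b y))
    where
    go : ∀ s t → [ f , g ]′ s ≡ [ f , g ]′ t → s ≡ t
    go (inj₁ i) (inj₁ j) eq = cong inj₁ (f-inj eq)
    go (inj₁ i) (inj₂ j) eq = contradiction eq (f≢g i j)
    go (inj₂ i) (inj₁ j) eq = contradiction (sym eq) (f≢g j i)
    go (inj₂ i) (inj₂ j) eq = cong inj₂ (g-inj eq)

-- Lists of sets, and decidable properties of sets

allSubsets : ∀ n → List (Subset n)
allSubsets zero    = [] ∷ []
allSubsets (suc n) = List.map (true ∷_) (allSubsets n) List.++ List.map (false ∷_) (allSubsets n)

∈-allSubsets : ∀ (s : Subset n) → s ∈ₗ allSubsets n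
∈-allSubsets []          = here refl
∈-allSubsets (true ∷ s)  = ∈-++⁺ˡ (∈-map⁺ (true ∷_) (∈-allSubsets s))
∈-allSubsets (false ∷ s) = ∈-++⁺ʳ _ (∈-map⁺ (false ∷_) (∈-allSubsets s))

allSubsets-unique : ∀ n → Unique (allSubsets n)
allSubsets-unique zero    = All.[] AllPairs.∷ AllPairs.[]
allSubsets-unique (suc n) = Uniqueₚ.++⁺
  (Uniqueₚ.map⁺ ∷-injectiveʳ (allSubsets-unique n))
  (Uniqueₚ.map⁺ ∷-injectiveʳ (allSubsets-unique n))
  disjoint
  where
  disjoint : ∀ {s} → ¬ (s ∈ₗ List.map (true ∷_) (allSubsets n) × s ∈ₗ List.map (false ∷_) (allSubsets n))
  disjoint (s∈ , s∈′) with _ , _ , refl ← ∈-map⁻ (true ∷_) s∈ | _ , _ , () ← ∈-map⁻ (false ∷_) s∈′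

length-allSubsets : ∀ n → length (allSubsets n) ≡ 2 ^ n
length-allSubsets zero    = refl
length-allSubsets (suc n) = trans
  (length-++ (List.map (true ∷_) (allSubsets n)))
  (cong₂ _+_ (trans (length-map _ (allSubsets n)) (length-allSubsets n))
    (trans (length-map _ (allSubsets n)) (trans (length-allSubsets n) (sym (ℕₚ.+-identityʳ _)))))

unique-lookup : ∀ {A : Set} {xs : List A} → Unique xs → Inj (List.lookup xs)
unique-lookup {xs = x ∷ xs} (x∉ AllPairs.∷ u) {zero}  {zero}  _  = refl
unique-lookup {xs = x ∷ xs} (x∉ AllPairs.∷ u) {zero}  {suc j} eq = contradiction eq (All.lookup x∉ (∈-lookup j))
unique-lookup {xs = x ∷ xs} (x∉ AllPairs.∷ u) {suc i} {zero}  eq = contradiction (sym eq) (All.lookup x∉ (∈-lookup i))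
unique-lookup {xs = x ∷ xs} (x∉ AllPairs.∷ u) {suc i} {suc j} eq = cong suc (unique-lookup u eq)

unique-⊆⇒length≤ : ∀ {A : Set} {xs ys : List A} → Unique xs → (∀ {x} → x ∈ₗ xs → x ∈ₗ ys) → length xs ≤ length ys
unique-⊆⇒length≤ {xs = xs} {ys} u sub = injective⇒≤ {f = pos} pos-inj
  where
  pos : Fin (length xs) → Fin (length ys)
  pos i = Any.index (sub (∈-lookup i))
  pos-inj : Inj pos
  pos-inj {i} {j} eq = unique-lookup u (trans (lookup-index (sub (∈-lookup i)))
    (trans (cong (List.lookup ys) eq) (sym (lookup-index (sub (∈-lookup j))))))

_≟ˢ_ : (s t : Subset n) → Dec (s ≡ t)
_≟ˢ_ = ≡-dec Boolₚ._≟_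

_∈ₗ?_ : (s : Subset n) (es : List (Subset n)) → Dec (s ∈ₗ es)
s ∈ₗ? es = DecMembership._∈?_ _≟ˢ_ s es

allSubset? : ∀ {P : Subset n → Set} → (∀ s → Dec (P s)) → Dec (∀ s → P s)
allSubset? {P = P} P? = map′
  (λ h s → decidable-stable (P? s) (λ ¬Ps → h (s , ¬Ps))) (λ h (s , ¬Ps) → ¬Ps (h s))
  (¬? (anySubset? (λ s → ¬? (P? s))))

-- The subset cut out by a decidable property.
subset : {P : Fin n → Set} → (∀ x → Dec (P x)) → Subset n
subset P? = tabulate (does ∘ P?)

∈-subset⁺ : ∀ {P : Fin n → Set} (P? : ∀ x → Dec (P x)) {x} → P x → x ∈ subset P?
∈-subset⁺ P? {x} Px = lookup⇒[]= x _ (trans (lookup∘tabulate (does ∘ P?) x) (dec-true (P? x) Px))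

∈-subset⁻ : ∀ {P : Fin n → Set} (P? : ∀ x → Dec (P x)) {x} → x ∈ subset P? → P x
∈-subset⁻ P? {x} x∈ with P? x | trans (sym (lookup∘tabulate (does ∘ P?) x)) ([]=⇒lookup x∈)
... | yes Px | _ = Px

-- Partitions, independent sets and a counting lemma

∣p∣+∣q─p∣≡∣q∣ : ∀ {p q : Subset n} → p ⊆ q → ∣ p ∣ + ∣ q ─ p ∣ ≡ ∣ q ∣
∣p∣+∣q─p∣≡∣q∣ {p = p} {q} p⊆q = trans
  (cong (λ X → ∣ X ∣ + ∣ q ─ p ∣) (⊆-antisym (λ x∈ → x∈p∩q⁺ (p⊆q x∈ , x∈)) (p∩q⊆q q p)))
  (∣p∩q∣+∣p─q∣≡∣p∣ q p)

-- If the sets K x partition the vertices into blocks of size suc k, then suc k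
-- divides the size of every union X of blocks. Blocks are removed one at a time;
-- N bounds the size of what is left.
partition⇒∣ : ∀ k (K : Fin n → Subset n) → (∀ x → x ∈ K x) → (∀ x → ∣ K x ∣ ≡ suc k) →
              (∀ {x y} → y ∈ K x → K y ≡ K x) →
              ∀ X → (∀ {x} → x ∈ X → K x ⊆ X) → suc k ∣ ∣ X ∣
partition⇒∣ {n} k K x∈K ∣K∣ same X = go ∣ X ∣ X ≤-refl
  where
  removeBlock : ∀ {X x} → K x ⊆ X → suc (k + ∣ X ─ K x ∣) ≡ ∣ X ∣
  removeBlock {X} {x} Kx⊆X = trans (cong (_+ ∣ X ─ K x ∣) (sym (∣K∣ x))) (∣p∣+∣q─p∣≡∣q∣ Kx⊆X)
  go : ∀ N (X : Subset n) → ∣ X ∣ ≤ N → (∀ {x} → x ∈ X → K x ⊆ X) → suc k ∣ ∣ X ∣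
  go N X ∣X∣≤N closed with nonempty? X
  ... | no empty = subst (suc k ∣_) (sym (trans (cong ∣_∣ (Empty-unique empty)) (∣⊥∣≡0 n))) (_ ∣0)
  go zero    X ∣X∣≤0 closed | yes (x , x∈X) =
    contradiction (≤-trans (≤-reflexive (removeBlock (closed x∈X))) ∣X∣≤0) λ ()
  go (suc N) X ∣X∣≤1+N closed | yes (x , x∈X) = subst (suc k ∣_) (removeBlock (closed x∈X))
    (∣m∣n⇒∣m+n ∣-refl (go N (X ─ K x)
      (≤-trans (ℕₚ.m≤n+m _ k) (ℕₚ.≤-pred (≤-trans (≤-reflexive (removeBlock (closed x∈X))) ∣X∣≤1+N))) closed′))
    where
    closed′ : ∀ {y} → y ∈ X ─ K x → K y ⊆ X ─ K x
    closed′ {y} y∈ z∈Ky = x∈p∧x∉q⇒x∈p─q (closed (p─q⊆p X (K x) y∈) z∈Ky)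
      (λ z∈Kx → x∈p─q⇒x∉q X (K x) y∈ (subst (y ∈_) (trans (sym (same z∈Ky)) (same z∈Kx)) (x∈K y)))

∣p∣≤∣p─q∣+∣q∣ : ∀ (p q : Subset n) → ∣ p ∣ ≤ ∣ p ─ q ∣ + ∣ q ∣
∣p∣≤∣p─q∣+∣q∣ p q = ≤-trans (≤-reflexive (trans (sym (∣p∩q∣+∣p─q∣≡∣p∣ p q)) (ℕₚ.+-comm ∣ p ∩ q ∣ _)))
  (ℕₚ.+-monoʳ-≤ ∣ p ─ q ∣ (∣p∩q∣≤∣q∣ p q))

length-cartesianProductWith : ∀ {A B C : Set} (f : A → B → C) xs ys →
                              length (List.cartesianProductWith f xs ys) ≡ length xs * length ys
length-cartesianProductWith f [] ys = refl
length-cartesianProductWith f (x ∷ xs) ys = trans (length-++ (List.map (f x) ys))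
  (cong₂ _+_ (length-map (f x) ys) (length-cartesianProductWith f xs ys))

-- A symmetric relation in which each vertex has at most D neighbours (itself
-- possibly among them) has an independent t-set inside every set of size
-- t (D + 1): choose greedily, discarding the neighbours of each chosen vertex.
module _ (_∼_ : Fin n → Fin n → Set) (∼-sym : ∀ {x y} → x ∼ y → y ∼ x)
         (nbrs : Fin n → Subset n) (∈-nbrs : ∀ {x y} → x ∼ y → y ∈ nbrs x)
         {D : ℕ} (∣nbrs∣≤D : ∀ x → ∣ nbrs x ∣ ≤ D) where

  closedNbrs : Fin n → Subset n
  closedNbrs x = insert x (nbrs x)

  ∣closedNbrs∣≤ : ∀ x → ∣ closedNbrs x ∣ ≤ suc D
  ∣closedNbrs∣≤ x = ≤-trans (∣p∪q∣≤∣p∣+∣q∣ ⁅ x ⁆ (nbrs x))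
    (≤-trans (≤-reflexive (cong (_+ ∣ nbrs x ∣) (∣⁅x⁆∣≡1 x))) (s≤s (∣nbrs∣≤D x)))

  ∉closedNbrs⇒≢ : ∀ {x y} → y ∉ closedNbrs x → x ≢ y
  ∉closedNbrs⇒≢ {x} y∉ refl = y∉ (x∈insert x (nbrs x))

  ∉closedNbrs⇒≁ : ∀ {x y} → y ∉ closedNbrs x → ¬ x ∼ y
  ∉closedNbrs⇒≁ {x} y∉ x∼y = y∉ (⊆insert x (nbrs x) (∈-nbrs x∼y))

  independent : ∀ t (X : Subset n) → t * suc D ≤ ∣ X ∣ →
                Σ[ x ∈ (Fin t → Fin n) ] ((∀ i → x i ∈ X) × Inj x × (∀ {i j} → i ≢ j → ¬ x i ∼ x j))
  independent zero    X _ = (λ ()) , (λ ()) , (λ { {()} }) , λ { {()} }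
  independent (suc t) X le with nonempty {X = X} (≤-trans (s≤s z≤n) le)
  ... | x₀ , x₀∈X with independent t (X ─ closedNbrs x₀)
        (ℕₚ.+-cancelʳ-≤ (suc D) _ _ (≤-trans (≤-reflexive (ℕₚ.+-comm (t * suc D) (suc D)))
          (≤-trans le (≤-trans (∣p∣≤∣p─q∣+∣q∣ X (closedNbrs x₀)) (ℕₚ.+-monoʳ-≤ _ (∣closedNbrs∣≤ x₀))))))
  ... | x , x∈ , x-inj , x-indep = x′ , x′∈X , x′-inj , x′-indep
    where
    x′ : Fin (suc t) → Fin n
    x′ zero    = x₀
    x′ (suc i) = x i
    x∉ : ∀ i → x i ∉ closedNbrs x₀
    x∉ i = x∈p─q⇒x∉q X (closedNbrs x₀) (x∈ i)
    x′∈X : ∀ i → x′ i ∈ X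
    x′∈X zero    = x₀∈X
    x′∈X (suc i) = p─q⊆p X (closedNbrs x₀) (x∈ i)
    x′-inj : Inj x′
    x′-inj {zero}  {zero}  _  = refl
    x′-inj {zero}  {suc j} eq = contradiction eq (∉closedNbrs⇒≢ (x∉ j))
    x′-inj {suc i} {zero}  eq = contradiction (sym eq) (∉closedNbrs⇒≢ (x∉ i))
    x′-inj {suc i} {suc j} eq = cong suc (x-inj eq)
    x′-indep : ∀ {i j} → i ≢ j → ¬ x′ i ∼ x′ j
    x′-indep {zero}  {zero}  i≢j = contradiction refl i≢j
    x′-indep {zero}  {suc j} _   = ∉closedNbrs⇒≁ (x∉ j)
    x′-indep {suc i} {zero}  _   = ∉closedNbrs⇒≁ (x∉ i) ∘ ∼-sym
    x′-indep {suc i} {suc j} i≢j = x-indep (i≢j ∘ cong suc)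

funToFin-cong : ∀ {a b} {f g : Fin a → Fin b} → (∀ i → f i ≡ g i) → funToFin f ≡ funToFin g
funToFin-cong {zero}  f≗g = refl
funToFin-cong {suc a} f≗g = cong₂ combine (f≗g zero) (funToFin-cong (f≗g ∘ suc))

-- The u ^ d transversals of a d by u array of vertices, each contained in one of
-- the r-sets in es, need many r-sets: a transversal is recovered from an r-set
-- containing it together with the positions of its d vertices in that r-set.
-- Injectivity within each row is enough for this.
coverBound : ∀ {r d u} (es : List (Subset n)) → All (λ e → ∣ e ∣ ≡ r) es →
  (x : Fin d → Fin u → Fin n) → (∀ i → Inj (x i)) →
  (∀ (φ : Fin d → Fin u) → ∃[ e ] (e ∈ₗ es × (∀ i → x i (φ i) ∈ e))) →
  u ^ d ≤ length es * r ^ d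
coverBound {n} {r} {d} {u} es uni x x-inj cover = injective⇒≤ {f = code} code-inj
  where
  enumAt : ∀ l → Enum (List.lookup es l) r
  enumAt l = enum _ (All.lookup uni (∈-lookup l))
  φ : Fin (u ^ d) → Fin d → Fin u
  φ = finToFun
  at : ∀ c → Fin (length es)
  at c = Any.index (proj₁ (proj₂ (cover (φ c))))
  x∈at : ∀ c i → x i (φ c i) ∈ List.lookup es (at c)
  x∈at c i = subst (x i (φ c i) ∈_) (lookup-index (proj₁ (proj₂ (cover (φ c))))) (proj₂ (proj₂ (cover (φ c))) i)
  pos : ∀ c → Fin d → Fin r
  pos c i = proj₁ (Enum.onto (enumAt (at c)) (x∈at c i))
  to-pos : ∀ c i → Enum.to (enumAt (at c)) (pos c i) ≡ x i (φ c i)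
  to-pos c i = proj₂ (Enum.onto (enumAt (at c)) (x∈at c i))
  code : Fin (u ^ d) → Fin (length es * r ^ d)
  code c = combine (at c) (funToFin (pos c))
  code-inj : Inj code
  code-inj {c} {c′} eq with at≡ , pos≡ ← combine-injective (at c) (funToFin (pos c)) (at c′) (funToFin (pos c′)) eq =
    trans (sym (funToFin-finToFin {d} {u} c)) (trans (funToFin-cong φ≡) (funToFin-finToFin {d} {u} c′))
    where
    pos≗ : ∀ i → pos c i ≡ pos c′ i
    pos≗ i = trans (sym (finToFun-funToFin (pos c) i))
      (trans (cong (λ p → finToFun p i) pos≡) (finToFun-funToFin (pos c′) i))
    φ≡ : ∀ i → φ c i ≡ φ c′ i
    φ≡ i = x-inj i (trans (sym (to-pos c i))
      (trans (cong₂ (λ l p → Enum.to (enumAt l) p) at≡ (pos≗ i)) (to-pos c′ i)))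

-- Unions of cliques as forbidden graphs

-- A pattern is a vertex set Fin N with a family of distinguished subsets, its
-- parts, the j-th part being given by an injection of Fin (card j). It stands
-- for the r-graph whose edges are the r-sets contained in some part.
record Pattern (N : ℕ) : Set where
  field
    parts    : ℕ
    card     : Fin parts → ℕ
    part     : ∀ j → Fin (card j) → Fin N
    part-inj : ∀ j → Inj (part j)

open Pattern

module _ (r : ℕ) {N : ℕ} (F : Pattern N) where

  IsEdge : Subset N → Set
  IsEdge s = ∣ s ∣ ≡ r × ∃[ j ] s ⊆ range (part F j)

  isEdge? : ∀ s → Dec (IsEdge s)
  isEdge? s = (∣ s ∣ ℕₚ.≟ r) ×-dec any? (λ j → s ⊆? range (part F j))

  graph : RGraph r N
  graph = mkRGraph (filter isEdge? (allSubsets N))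
    (All.tabulate (λ s∈ → proj₁ (proj₂ (∈-filter⁻ isEdge? {xs = allSubsets N} s∈))))
    (Uniqueₚ.filter⁺ isEdge? (allSubsets-unique N))

  ∈-graph⁺ : ∀ {s} → IsEdge s → s ∈ₗ edges graph
  ∈-graph⁺ {s} = ∈-filter⁺ isEdge? (∈-allSubsets s)

  ∈-graph⁻ : ∀ {s} → s ∈ₗ edges graph → IsEdge s
  ∈-graph⁻ s∈ = proj₂ (∈-filter⁻ isEdge? {xs = allSubsets N} s∈)

-- X spans a complete r-graph in the edge set es. A set of fewer than r vertices
-- does so vacuously, and a set of size r does so exactly if it is an edge.
Clique : ℕ → List (Subset n) → Subset n → Set
Clique r es X = ∀ s → ∣ s ∣ ≡ r → s ⊆ X → s ∈ₗ es

Clique-⊆ : ∀ {r} {es : List (Subset n)} {X Y} → X ⊆ Y → Clique r es Y → Clique r es X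
Clique-⊆ X⊆Y cl s ∣s∣ s⊆X = cl s ∣s∣ (X⊆Y ∘ s⊆X)

edge⇒Clique : ∀ {r} {es : List (Subset n)} {e} → ∣ e ∣ ≡ r → e ∈ₗ es → Clique r es e
edge⇒Clique {es = es} ∣e∣ e∈ s ∣s∣ s⊆e =
  subst (_∈ₗ es) (sym (⊆∧∣≥∣⇒≡ s⊆e (≤-reflexive (trans ∣e∣ (sym ∣s∣))))) e∈

Clique⇒edge : ∀ {r} {es : List (Subset n)} {e} → ∣ e ∣ ≡ r → Clique r es e → e ∈ₗ es
Clique⇒edge ∣e∣ cl = cl _ ∣e∣ id

Clique? : ∀ r (es : List (Subset n)) X → Dec (Clique r es X)
Clique? r es X = allSubset? (λ s → (∣ s ∣ ℕₚ.≟ r) →-dec ((s ⊆? X) →-dec (s ∈ₗ? es)))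

-- An embedding of the vertices of F that sends every part to a clique. This is
-- the same as containing graph r F, by the two lemmas below.
record Copy {N n : ℕ} (r : ℕ) (F : Pattern N) (es : List (Subset n)) : Set where
  constructor mkCopy
  field
    emb     : Fin N → Fin n
    emb-inj : Inj emb
    cliques : ∀ j → Clique r es (range (emb ∘ part F j))

open Copy

module _ {N n r : ℕ} {F : Pattern N} {es : List (Subset n)} (c : Copy r F es) where

  -- The image of the j-th part.
  copyOf : ∀ j → Subset n
  copyOf j = range (emb c ∘ part F j)

  ∣copyOf∣ : ∀ j → ∣ copyOf j ∣ ≡ card F j
  ∣copyOf∣ j = ∣range∣ (part-inj F j ∘ emb-inj c)

module _ {N n r : ℕ} (F : Pattern N) (H : RGraph r n) where

  Copy⇒⊑ : Copy r F (edges H) → graph r F ⊑ H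
  Copy⇒⊑ (mkCopy f f-inj cl) = mk↣ f-inj , λ e e∈ → edge e (∈-graph⁻ r F e∈)
    where
    edge : ∀ e → IsEdge r F e → image f e ∈ₗ edges H
    edge e (∣e∣ , j , e⊆) = cl j (image f e) (trans (∣image∣ f-inj e) ∣e∣) sub
      where
      sub : image f e ⊆ range (f ∘ part F j)
      sub y∈ with x , x∈ , refl ← ∈-image⁻ f e y∈
             with i , refl ← ∈-range⁻ (part F j) (e⊆ x∈) = ∈-range⁺ (f ∘ part F j) i

  ⊑⇒Copy : graph r F ⊑ H → Copy r F (edges H)
  ⊑⇒Copy (φ , edge) = mkCopy f inj cl
    where
    f = Injection.to φ
    inj : Inj f
    inj = Injection.injective φ
    cl : ∀ j → Clique r (edges H) (range (f ∘ part F j))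
    cl j s ∣s∣ s⊆ = subst (_∈ₗ edges H) eq (edge s′ (∈-graph⁺ r F (∣s′∣ , j , s′⊆)))
      where
      s′ = preimage f s
      s⊆f : s ⊆ range f
      s⊆f y∈ with i , refl ← ∈-range⁻ (f ∘ part F j) (s⊆ y∈) = ∈-range⁺ f _
      eq : image f s′ ≡ s
      eq = image-preimage f s⊆f
      ∣s′∣ : ∣ s′ ∣ ≡ r
      ∣s′∣ = trans (sym (∣image∣ inj s′)) (trans (cong ∣_∣ eq) ∣s∣)
      s′⊆ : s′ ⊆ range (part F j)
      s′⊆ x∈ with i , eq′ ← ∈-range⁻ (f ∘ part F j) (s⊆ (∈-preimage⁻ f s x∈)) =
        subst (_∈ range (part F j)) (inj eq′) (∈-range⁺ (part F j) i)

-- Two cliques, of orders a + c and c + b, sharing exactly c vertices.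
glue : ∀ a c b → Pattern (a + (c + b))
glue a c b = record
  { parts    = 2
  ; card     = λ { zero → a + c ; (suc zero) → c + b }
  ; part     = λ { zero → left ; (suc zero) → a ↑ʳ_ }
  ; part-inj = λ { zero → left-inj ; (suc zero) → ↑ʳ-injective a _ _ }
  }
  where
  left : Fin (a + c) → Fin (a + (c + b))
  left = (_↑ˡ (c + b)) ⊕ (λ i → a ↑ʳ (i ↑ˡ b))
  left-inj : Inj left
  left-inj = ⊕-inj _ _ (↑ˡ-injective _ _ _) (λ eq → ↑ˡ-injective _ _ _ (↑ʳ-injective a _ _ eq))
    (λ i j → ↑ˡ≢↑ʳ i (j ↑ˡ b))

-- A clique of order c + s and t further vertices, each of which spans a clique of
-- order c + 1 with the same c vertices of that clique.
sunflower : ∀ c s t → Pattern ((c + s) + t)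
sunflower c s t = record
  { parts    = suc t
  ; card     = λ { zero → c + s ; (suc _) → c + 1 }
  ; part     = λ { zero → _↑ˡ t ; (suc j) → petal j }
  ; part-inj = λ { zero → ↑ˡ-injective t _ _ ; (suc j) → petal-inj j }
  }
  where
  petal : Fin t → Fin (c + 1) → Fin ((c + s) + t)
  petal j = (λ i → (i ↑ˡ s) ↑ˡ t) ⊕ (λ _ → (c + s) ↑ʳ j)
  petal-inj : ∀ j → Inj (petal j)
  petal-inj j = ⊕-inj _ _ (λ eq → ↑ˡ-injective s _ _ (↑ˡ-injective t _ _ eq))
    (λ { {zero} {zero} _ → refl }) (λ i _ → ↑ˡ≢↑ʳ (i ↑ˡ s) j)

-- A clique of order r, the body, and r disjoint cliques of order suc k, the legs,
-- each meeting the body in one vertex. With edges of size r the body is an edge.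
spider : ∀ r k → Pattern (r * suc k)
spider r k = record
  { parts    = suc r
  ; card     = λ { zero → r ; (suc _) → suc k }
  ; part     = λ { zero i → combine i zero ; (suc i) → combine i }
  ; part-inj = λ { zero → combine-injectiveˡ _ _ _ _ ; (suc i) → combine-injectiveʳ i _ i _ }
  }

-- j disjoint cliques of order m.
blocks : ∀ j m → Pattern (j * m)
blocks j m = record
  { parts    = j
  ; card     = λ _ → m
  ; part     = combine
  ; part-inj = λ i → combine-injectiveʳ i _ i _
  }

module _ {r : ℕ} {es : List (Subset n)} where

  copy-glue : ∀ {a c b X Y} → Clique r es X → Clique r es Y →
              ∣ X ─ Y ∣ ≡ a → ∣ X ∩ Y ∣ ≡ c → ∣ Y ─ X ∣ ≡ b → Copy r (glue a c b) es
  copy-glue {a} {c} {b} {X} {Y} clX clY ∣a∣ ∣c∣ ∣b∣ = mkCopy f f-inj λ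
    { zero       → Clique-⊆ (range⊆ _ (⊕-∈ _ _ {P = λ x → f x ∈ X} inXˡ inXʳ)) clX
    ; (suc zero) → Clique-⊆ (range⊆ _ inY) clY
    }
    where
    module A = Enum (enum (X ─ Y) ∣a∣)
    module C = Enum (enum (X ∩ Y) ∣c∣)
    module B = Enum (enum (Y ─ X) ∣b∣)
    f : Fin (a + (c + b)) → Fin n
    f = A.to ⊕ (C.to ⊕ B.to)
    C∈X : ∀ i → C.to i ∈ X
    C∈X i = proj₁ (x∈p∩q⁻ X Y (C.to∈ i))
    C∈Y : ∀ i → C.to i ∈ Y
    C∈Y i = proj₂ (x∈p∩q⁻ X Y (C.to∈ i))
    C⊕B∈Y : ∀ i → (C.to ⊕ B.to) i ∈ Y
    C⊕B∈Y = ⊕-∈ C.to B.to {P = _∈ Y} C∈Y (λ i → p─q⊆p Y X (B.to∈ i))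
    f-inj : Inj f
    f-inj = ⊕-inj _ _ A.inj
      (⊕-inj _ _ C.inj B.inj (λ i j eq → x∈p─q⇒x∉q Y X (subst (_∈ Y ─ X) (sym eq) (B.to∈ j)) (C∈X i)))
      (λ i j eq → x∈p─q⇒x∉q X Y (A.to∈ i) (subst (_∈ Y) (sym eq) (C⊕B∈Y j)))
    inXˡ : ∀ i → f (i ↑ˡ (c + b)) ∈ X
    inXˡ i = subst (_∈ X) (sym (⊕-ˡ A.to (C.to ⊕ B.to) i)) (p─q⊆p X Y (A.to∈ i))
    inXʳ : ∀ i → f (a ↑ʳ (i ↑ˡ b)) ∈ X
    inXʳ i = subst (_∈ X) (sym (trans (⊕-ʳ A.to (C.to ⊕ B.to) _) (⊕-ˡ C.to B.to i))) (C∈X i)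
    inY : ∀ i → f (a ↑ʳ i) ∈ Y
    inY i = subst (_∈ Y) (sym (⊕-ʳ A.to (C.to ⊕ B.to) i)) (C⊕B∈Y i)

  copy-sunflower : ∀ {c s t A C} (y : Fin t → Fin n) → Clique r es A → ∣ A ∣ ≡ c + s → C ⊆ A → ∣ C ∣ ≡ c →
                   Inj y → (∀ j → y j ∉ A) → (∀ j → Clique r es (insert (y j) C)) →
                   Copy r (sunflower c s t) es
  copy-sunflower {c} {s} {t} {A} {C} y clA ∣A∣ C⊆A ∣C∣ y-inj y∉A clC = mkCopy f f-inj λ
    { zero    → Clique-⊆ (range⊆ _ inA) clA
    ; (suc j) → Clique-⊆ (range⊆ _ (⊕-∈ _ _ {P = λ x → f x ∈ insert (y j) C} inC (iny j))) (clC j)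
    }
    where
    A∩C≡C : A ∩ C ≡ C
    A∩C≡C = ⊆-antisym (p∩q⊆q A C) (λ x∈ → x∈p∩q⁺ (C⊆A x∈ , x∈))
    ∣A─C∣ : ∣ A ─ C ∣ ≡ s
    ∣A─C∣ = ℕₚ.+-cancelˡ-≡ c _ _ (trans (cong (_+ ∣ A ─ C ∣) (trans (sym ∣C∣) (cong ∣_∣ (sym A∩C≡C))))
              (trans (∣p∩q∣+∣p─q∣≡∣p∣ A C) ∣A∣))
    module K = Enum (enum C ∣C∣)
    module R = Enum (enum (A ─ C) ∣A─C∣)
    g : Fin (c + s) → Fin n
    g = K.to ⊕ R.to
    g∈A : ∀ i → g i ∈ A
    g∈A = ⊕-∈ _ _ {P = _∈ A} (λ i → C⊆A (K.to∈ i)) (λ i → p─q⊆p A C (R.to∈ i))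
    f : Fin ((c + s) + t) → Fin n
    f = g ⊕ y
    f-inj : Inj f
    f-inj = ⊕-inj _ _
      (⊕-inj _ _ K.inj R.inj (λ i j eq → x∈p─q⇒x∉q A C (R.to∈ j) (subst (_∈ C) eq (K.to∈ i))))
      y-inj (λ i j eq → y∉A j (subst (_∈ A) eq (g∈A i)))
    inA : ∀ i → f (i ↑ˡ t) ∈ A
    inA i = subst (_∈ A) (sym (⊕-ˡ g y i)) (g∈A i)
    inC : ∀ {j} i → f ((i ↑ˡ s) ↑ˡ t) ∈ insert (y j) C
    inC {j} i = subst (_∈ insert (y j) C) (sym (trans (⊕-ˡ g y _) (⊕-ˡ K.to R.to i))) (⊆insert (y j) C (K.to∈ i))
    iny : ∀ j (_ : Fin 1) → f ((c + s) ↑ʳ j) ∈ insert (y j) C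
    iny j _ = subst (_∈ insert (y j) C) (sym (⊕-ʳ g y j)) (x∈insert (y j) C)

  copy-spider : ∀ {k e} → ∣ e ∣ ≡ r → e ∈ₗ es → (X : Fin n → Subset n) →
                (∀ {x} → x ∈ e → x ∈ X x × ∣ X x ∣ ≡ suc k × Clique r es (X x)) →
                (∀ {x y} → x ∈ e → y ∈ e → x ≢ y → Disjoint (X x) (X y)) →
                Copy r (spider r k) es
  copy-spider {k} {e} ∣e∣ e∈ X hX dis = mkCopy f f-inj λ
    { zero    → Clique-⊆ (range⊆ _ core) (edge⇒Clique ∣e∣ e∈)
    ; (suc i) → Clique-⊆ (range⊆ _ (leg i)) (proj₂ (proj₂ (hX (E.to∈ i))))
    }
    where
    module E = Enum (enum e ∣e∣)
    Xᵢ : Fin r → Subset n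
    Xᵢ i = X (E.to i)
    L : ∀ i → Enum (Xᵢ i - E.to i) k
    L i = enum _ (ℕₚ.suc-injective (trans (∣p-x∣ (proj₁ (hX (E.to∈ i)))) (proj₁ (proj₂ (hX (E.to∈ i))))))
    g : Fin r → Fin (suc k) → Fin n
    g i zero    = E.to i
    g i (suc l) = Enum.to (L i) l
    g∈ : ∀ i l → g i l ∈ Xᵢ i
    g∈ i zero    = proj₁ (hX (E.to∈ i))
    g∈ i (suc l) = p─q⊆p (Xᵢ i) ⁅ E.to i ⁆ (Enum.to∈ (L i) l)
    g≢ : ∀ i l → E.to i ≢ Enum.to (L i) l
    g≢ i l eq = x∈p─q⇒x∉q (Xᵢ i) ⁅ E.to i ⁆ (Enum.to∈ (L i) l) (subst (_∈ ⁅ E.to i ⁆) eq (x∈⁅x⁆ _))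
    g-injʳ : ∀ i {l l′} → g i l ≡ g i l′ → l ≡ l′
    g-injʳ i {zero}  {zero}   _  = refl
    g-injʳ i {zero}  {suc l′} eq = contradiction eq (g≢ i l′)
    g-injʳ i {suc l} {zero}   eq = contradiction (sym eq) (g≢ i l)
    g-injʳ i {suc l} {suc l′} eq = cong suc (Enum.inj (L i) eq)
    g-injˡ : ∀ {i i′ l l′} → g i l ≡ g i′ l′ → i ≡ i′
    g-injˡ {i} {i′} {l} {l′} eq with i Finₚ.≟ i′
    ... | yes i≡i′ = i≡i′
    ... | no  i≢i′ = contradiction (subst (_∈ Xᵢ i′) (sym eq) (g∈ i′ l′))
      (dis (E.to∈ i) (E.to∈ i′) (i≢i′ ∘ E.inj) (g∈ i l))
    f : Fin (r * suc k) → Fin n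
    f x = uncurry g (remQuot {r} (suc k) x)
    f-combine : ∀ i l → f (combine i l) ≡ g i l
    f-combine i l = cong (uncurry g) (remQuot-combine i l)
    f-inj : Inj f
    f-inj {x} {y} eq with i , l , refl ← combine-surjective {r} {suc k} x
                     with i′ , l′ , refl ← combine-surjective {r} {suc k} y
                     with refl ← g-injˡ {i} {i′} {l} {l′} (trans (sym (f-combine i l)) (trans eq (f-combine i′ l′)))
                     with refl ← g-injʳ i {l} {l′} (trans (sym (f-combine i l)) (trans eq (f-combine i l′))) = refl
    core : ∀ i → f (combine i zero) ∈ e
    core i = subst (_∈ e) (sym (f-combine i zero)) (E.to∈ i)
    leg : ∀ i l → f (combine i l) ∈ Xᵢ i
    leg i l = subst (_∈ Xᵢ i) (sym (f-combine i l)) (g∈ i l)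

-- Connected patterns and disjoint cliques

-- A pattern is connected if a colouring of its vertices that is constant on each
-- part is constant.
Connected : ∀ {N} → Pattern N → Set₁
Connected {N} F = ∀ {B : Set} (b : Fin N → B) →
  (∀ j k l → b (part F j k) ≡ b (part F j l)) → ∀ x y → b x ≡ b y

connected-via : ∀ {N} (F : Pattern N) (x₀ : Fin N) →
  (∀ {B : Set} (b : Fin N → B) → (∀ j k l → b (part F j k) ≡ b (part F j l)) → ∀ x → b x ≡ b x₀) →
  Connected F
connected-via F x₀ h b const x y = trans (h b const x) (sym (h b const y))

glue-connected : ∀ a c b → Connected (glue a (suc c) b)
glue-connected a c b = connected-via (glue a (suc c) b) (a ↑ʳ zero) λ f const →
  let
    ˡ≡ : ∀ i j → f (i ↑ˡ suc (c + b)) ≡ f (a ↑ʳ (j ↑ˡ b))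
    ˡ≡ i j = trans (cong f (sym (⊕-ˡ _ _ i))) (trans (const zero (i ↑ˡ suc c) (a ↑ʳ j)) (cong f (⊕-ʳ {a} (_↑ˡ (suc c + b)) (λ z → a ↑ʳ (z ↑ˡ b)) j)))
  in elim-+ a (λ x → f x ≡ f (a ↑ʳ zero)) (λ i → ˡ≡ i zero) (λ j → const (suc zero) j zero)

sunflower-connected : ∀ c s t → Connected (sunflower (suc c) s t)
sunflower-connected c s t = connected-via (sunflower (suc c) s t) zero λ f const →
  let
    ʳ≡ : ∀ j → f ((suc c + s) ↑ʳ j) ≡ f zero
    ʳ≡ j = trans (cong f (sym (⊕-ʳ {suc c} _ _ (zero {0})))) (const (suc j) (suc c ↑ʳ (zero {0})) zero)
  in elim-+ (suc c + s) (λ x → f x ≡ f zero) (λ i → const zero i zero) ʳ≡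

spider-connected : ∀ r k → Connected (spider (suc r) k)
spider-connected r k = connected-via (spider (suc r) k) zero λ f const x →
  let i , l , eq = combine-surjective {suc r} {suc k} x
  in trans (cong f (sym eq)) (trans (const (suc i) l zero) (const zero i zero))

module _ (r j m : ℕ) (2≤r : 2 ≤ r) where

  inBlock : ∀ {s} → s ∈ₗ edges (graph r (blocks j m)) → ∀ {x y} → x ∈ s → y ∈ s →
            quotient {j} m x ≡ quotient {j} m y
  inBlock s∈ x∈ y∈ with _ , i , s⊆ ← ∈-graph⁻ r (blocks j m) s∈
    with a , refl ← ∈-range⁻ (combine i) (s⊆ x∈) | b , refl ← ∈-range⁻ (combine i) (s⊆ y∈) =
    trans (cong proj₁ (remQuot-combine i a)) (sym (cong proj₁ (remQuot-combine i b)))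

  -- A clique of order at least r in a disjoint union of cliques lies in one of them,
  -- and hence so does a copy of a connected pattern.
  connected⇒¬Copy : ∀ {N} (F : Pattern N) → Connected F → (∀ i → r ≤ card F i) → m < N →
                    ¬ Copy r F (edges (graph r (blocks j m)))
  connected⇒¬Copy {N} F conn r≤ m<N (mkCopy f f-inj cl) =
    contradiction (≤-trans m<N (injective⇒≤ {f = remainder {j} m ∘ f} inj)) ℕₚ.1+n≰n
    where
    const : ∀ i k l → quotient {j} m (f (part F i k)) ≡ quotient {j} m (f (part F i l))
    const i k l = inBlock Z∈ (⊆Z (x∈pair x y)) (⊆Z (y∈pair x y))
      where
      x = f (part F i k)
      y = f (part F i l)
      between = interpolate (pair⊆ {X = range (f ∘ part F i)} (∈-range⁺ (f ∘ part F i) k) (∈-range⁺ (f ∘ part F i) l))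
        (≤-trans (∣pair∣≤2 x y) 2≤r)
        (≤-trans (r≤ i) (≤-reflexive (sym (∣range∣ (part-inj F i ∘ f-inj)))))
      Z = proj₁ between
      ⊆Z : pair x y ⊆ Z
      ⊆Z = proj₁ (proj₂ between)
      Z∈ : Z ∈ₗ edges (graph r (blocks j m))
      Z∈ = cl i Z (proj₂ (proj₂ (proj₂ between))) (proj₁ (proj₂ (proj₂ between)))
    inj : ∀ {x y} → remainder {j} m (f x) ≡ remainder {j} m (f y) → x ≡ y
    inj {x} {y} eq = f-inj (trans (sym (combine-remQuot {j} m (f x)))
      (trans (cong₂ combine (conn (quotient {j} m ∘ f) const x y) eq) (combine-remQuot {j} m (f y))))

-- Adding an edge with an uncovered face

-- Let e be the r-set T together with v, where no edge in es contains T. A clique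
-- of order more than r which used the new edge e would contain a vertex w outside
-- e, and then T with w would be an old edge containing T. So large cliques are old.
module Tight {r n : ℕ} (es : List (Subset n)) {v : Fin n} {T : Subset n}
             (v∉T : v ∉ T) (∣T∣ : suc ∣ T ∣ ≡ r) (uncovered : ∀ {s} → s ∈ₗ es → ¬ T ⊆ s) where

  e : Subset n
  e = insert v T

  ∣e∣ : ∣ e ∣ ≡ r
  ∣e∣ = trans (∣insert∣ v∉T) ∣T∣

  large⇒Clique : ∀ {X} → r < ∣ X ∣ → Clique r (e ∷ es) X → Clique r es X
  large⇒Clique {X} r<∣X∣ cl s ∣s∣ s⊆X with cl s ∣s∣ s⊆X
  ... | there s∈ = s∈
  ... | here refl with ⊆⊎⊈ X e
  ... | inj₁ X⊆e = contradiction (≤-trans r<∣X∣ (≤-trans (p⊆q⇒∣p∣≤∣q∣ X⊆e) (≤-reflexive ∣e∣))) ℕₚ.1+n≰n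
  ... | inj₂ (w , w∈X , w∉e) with cl (insert w T) (trans (∣insert∣ w∉T) ∣T∣) w+T⊆X
    where
    w∉T : w ∉ T
    w∉T w∈T = w∉e (⊆insert v T w∈T)
    w+T⊆X : insert w T ⊆ X
    w+T⊆X y∈ with ∈-insert⁻ y∈
    ... | inj₁ refl = w∈X
    ... | inj₂ y∈T  = s⊆X (⊆insert v T y∈T)
  ... | there w+T∈ = ⊥-elim (uncovered w+T∈ (⊆insert w T))
  ... | here eq    = contradiction (subst (w ∈_) eq (x∈insert w T)) w∉e

  module _ {N} {F : Pattern N} (c : Copy r F (e ∷ es)) where

    largePart : ∀ j → r < card F j → Clique r es (copyOf c j)
    largePart j r<card = large⇒Clique (≤-trans r<card (≤-reflexive (sym (∣copyOf∣ c j)))) (cliques c j)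

    smallPart : ∀ j → card F j ≡ r → copyOf c j ≡ e ⊎ Clique r es (copyOf c j)
    smallPart j card≡r with Clique⇒edge (trans (∣copyOf∣ c j) card≡r) (cliques c j)
    ... | here eq  = inj₁ eq
    ... | there ∈es = inj₂ (edge⇒Clique (trans (∣copyOf∣ c j) card≡r) ∈es)

    tight⇒Copy : (∀ j → r < card F j) → Copy r F es
    tight⇒Copy large = mkCopy (emb c) (emb-inj c) λ j → largePart j (large j)

-- Saturation numbers exist

infix 4 _⊑?_

-- Containment is decided by trying the finitely many maps between the vertex sets.
_⊑?_ : ∀ {r} (F : RGraph r l) (H : RGraph r n) → Dec (F ⊑ H)
_⊑?_ {l} {n} F H = map′ to from (any? embeds?)
  where
  Embeds : Fin (n ^ l) → Set
  Embeds c = (∀ x y → finToFun {n} {l} c x ≡ finToFun c y → x ≡ y) ×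
             All (λ e → image (finToFun {n} {l} c) e ∈ₗ edges H) (edges F)
  embeds? : ∀ c → Dec (Embeds c)
  embeds? c = all? (λ x → all? λ y → (finToFun {n} {l} c x Finₚ.≟ finToFun c y) →-dec (x Finₚ.≟ y)) ×-dec
              All.all? (λ e → image (finToFun {n} {l} c) e ∈ₗ? edges H) (edges F)
  to : ∃ Embeds → F ⊑ H
  to (c , inj , edge) = mk↣ (inj _ _) , λ e e∈ → All.lookup edge e∈
  from : F ⊑ H → ∃ Embeds
  from (φ , edge) = funToFin f ,
    (λ x y eq → Injection.injective φ (trans (sym (f≗ x)) (trans eq (f≗ y)))) ,
    All.tabulate (λ {e} e∈ → subst (_∈ₗ edges H) (sym (image-cong f≗ e)) (edge e e∈))
    where
    f = Injection.to φ
    f≗ = finToFun-funToFin f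

⊑-mono : ∀ {r} {F : RGraph r l} {H H′ : RGraph r n} →
         (∀ {e} → e ∈ₗ edges H → e ∈ₗ edges H′) → F ⊑ H → F ⊑ H′
⊑-mono H⊆H′ (φ , edge) = φ , λ e e∈ → H⊆H′ (edge e e∈)

module _ {r k : ℕ} (𝓕 : Family r k) where

  -- H contains no member of the family.
  FreeOf : RGraph r n → Set
  FreeOf H = ∀ i → ¬ proj₂ (𝓕 i) ⊑ H

  freeOf? : (H : RGraph r n) → Dec (FreeOf H)
  freeOf? H = all? (λ i → ¬? (proj₂ (𝓕 i) ⊑? H))

  saturated? : (H : RGraph r n) → Dec (Saturated 𝓕 H)
  saturated? H = freeOf? H ×-dec allSubset? creates?
    where
    creates? : ∀ e → Dec (∀ (∣e∣≡r : ∣ e ∣ ≡ r) (e∉H : e ∉ₗ edges H) → ∃[ i ] proj₂ (𝓕 i) ⊑ addEdge H e ∣e∣≡r e∉H)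
    creates? e with ∣ e ∣ ℕₚ.≟ r | e ∈ₗ? edges H
    ... | no ∣e∣≢r   | _       = yes λ ∣e∣≡r → contradiction ∣e∣≡r ∣e∣≢r
    ... | yes _      | yes e∈H = yes λ _ e∉H → contradiction e∈H e∉H
    ... | yes ∣e∣≡r  | no e∉H  = map′ (λ c _ _ → c) (λ c → c ∣e∣≡r e∉H)
                                   (any? (λ i → proj₂ (𝓕 i) ⊑? addEdge H e ∣e∣≡r e∉H))

  Saturated-resp : ∀ {H H′ : RGraph r n} → (∀ {e} → e ∈ₗ edges H → e ∈ₗ edges H′) →
                   (∀ {e} → e ∈ₗ edges H′ → e ∈ₗ edges H) → Saturated 𝓕 H → Saturated 𝓕 H′
  Saturated-resp {H = H} {H′} H⊆H′ H′⊆H (free , creates) =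
    (λ i c → free i (⊑-mono {F = proj₂ (𝓕 i)} {H′} {H} H′⊆H c)) ,
    λ e ∣e∣≡r e∉H′ → let i , c = creates e ∣e∣≡r (e∉H′ ∘ H⊆H′) in
      i , ⊑-mono {F = proj₂ (𝓕 i)} {addEdge H e ∣e∣≡r (e∉H′ ∘ H⊆H′)} {addEdge H′ e ∣e∣≡r e∉H′}
                 (λ { (here eq) → here eq ; (there e∈) → there (H⊆H′ e∈) }) c

sublists : ∀ {A : Set} → List A → List (List A)
sublists []       = [] ∷ []
sublists (x ∷ xs) = sublists xs List.++ List.map (x ∷_) (sublists xs)

filter∈sublists : ∀ {A : Set} {P : A → Set} (P? : ∀ x → Dec (P x)) xs → filter P? xs ∈ₗ sublists xs
filter∈sublists P? [] = here refl
filter∈sublists P? (x ∷ xs) with does (P? x)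
... | true  = ∈-++⁺ʳ (sublists xs) (∈-map⁺ (x ∷_) (filter∈sublists P? xs))
... | false = ∈-++⁺ˡ (filter∈sublists P? xs)

-- Every graph has, up to the order of its edges, a sublist of the list of all
-- vertex sets as edge list; so properties of graphs which do not depend on that
-- order can be decided by a finite search.
module _ {r : ℕ} (Q : RGraph r n → Set) (Q? : ∀ H → Dec (Q H))
         (resp : ∀ {H H′} → (∀ {e} → e ∈ₗ edges H → e ∈ₗ edges H′) →
                 (∀ {e} → e ∈ₗ edges H′ → e ∈ₗ edges H) → Q H → Q H′) where

  private
    OnList : List (Subset n) → Set
    OnList es = Σ[ u ∈ All (λ e → ∣ e ∣ ≡ r) es ] Σ[ d ∈ Unique es ] Q (mkRGraph es u d)

    onList? : ∀ es → Dec (OnList es)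
    onList? es with All.all? (λ e → ∣ e ∣ ℕₚ.≟ r) es | unique? _≟ˢ_ es
    ... | no ¬u | _    = no (¬u ∘ proj₁)
    ... | yes _ | no ¬d = no (¬d ∘ proj₁ ∘ proj₂)
    ... | yes u | yes d = map′ (λ q → u , d , q) (λ (_ , _ , q) → resp id id q) (Q? (mkRGraph es u d))

  anyRGraph? : Dec (∃ Q)
  anyRGraph? = map′ to from (Any.any? onList? (sublists (allSubsets n)))
    where
    to : Any OnList (sublists (allSubsets n)) → ∃ Q
    to any with _ , _ , _ , _ , q ← find any = _ , q
    from : ∃ Q → Any OnList (sublists (allSubsets n))
    from (H , q) = lose (filter∈sublists inH? (allSubsets n)) (u , d , resp H⊆ ⊆H q)
      where
      inH? = λ e → e ∈ₗ? edges H
      es = filter inH? (allSubsets n)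
      ⊆H : ∀ {e} → e ∈ₗ es → e ∈ₗ edges H
      ⊆H e∈ = proj₂ (∈-filter⁻ inH? {xs = allSubsets n} e∈)
      H⊆ : ∀ {e} → e ∈ₗ edges H → e ∈ₗ es
      H⊆ {e} = ∈-filter⁺ inH? (∈-allSubsets e)
      u = All.tabulate (λ e∈ → All.lookup (uniform H) (⊆H e∈))
      d = Uniqueₚ.filter⁺ inH? (allSubsets-unique n)

least : ∀ {P : ℕ → Set} → (∀ c → Dec (P c)) → ∃ P → ∃[ c ] (P c × (∀ c′ → P c′ → c ≤ c′))
least {P} P? (b , Pb) = go b 0 (λ _ _ → z≤n) (subst P (sym (ℕₚ.+-identityʳ b)) Pb)
  where
  go : ∀ fuel c → (∀ c′ → P c′ → c ≤ c′) → P (fuel + c) → ∃[ c ] (P c × (∀ c′ → P c′ → c ≤ c′))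
  go zero       c lower Pc = c , Pc , lower
  go (suc fuel) c lower P+ with P? c
  ... | yes Pc = c , Pc , lower
  ... | no ¬Pc = go fuel (suc c) (λ c′ Pc′ → ℕₚ.≤∧≢⇒< (lower c′ Pc′) (λ { refl → ¬Pc Pc′ }))
                   (subst P (sym (ℕₚ.+-suc fuel c)) P+)

module _ {r k : ℕ} (𝓕 : Family r k) (nonempty : ∀ i → ∃[ e ] e ∈ₗ edges (proj₂ (𝓕 i))) where

  -- Going through a list L of vertex sets, add those which are new edges and create
  -- no forbidden graph. What was rejected stays forbidden, as edges are only added.
  greedy : ∀ (L : List (Subset n)) (H : RGraph r n) → FreeOf 𝓕 H →
           Σ[ H′ ∈ RGraph r n ] ((∀ {e} → e ∈ₗ edges H → e ∈ₗ edges H′) × FreeOf 𝓕 H′ ×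
             (∀ {e} → e ∈ₗ L → ∀ (∣e∣≡r : ∣ e ∣ ≡ r) (e∉H′ : e ∉ₗ edges H′) → ∃[ i ] proj₂ (𝓕 i) ⊑ addEdge H′ e ∣e∣≡r e∉H′))
  greedy [] H free = H , id , free , λ ()
  greedy (e ∷ L) H free with ∣ e ∣ ℕₚ.≟ r | e ∈ₗ? edges H
  ... | no ∣e∣≢r | _ with H′ , H⊆ , free′ , creates ← greedy L H free =
    H′ , H⊆ , free′ , λ { (here refl) ∣e∣≡r _ → contradiction ∣e∣≡r ∣e∣≢r ; (there e∈) → creates e∈ }
  ... | yes _ | yes e∈H with H′ , H⊆ , free′ , creates ← greedy L H free =
    H′ , H⊆ , free′ , λ { (here refl) _ e∉H′ → contradiction (H⊆ e∈H) e∉H′ ; (there e∈) → creates e∈ }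
  ... | yes ∣e∣≡r | no e∉H with freeOf? 𝓕 (addEdge H e ∣e∣≡r e∉H)
  ... | yes free₁ with H′ , H⊆ , free′ , creates ← greedy L (addEdge H e ∣e∣≡r e∉H) free₁ =
    H′ , H⊆ ∘ there , free′ , λ { (here refl) _ e∉H′ → contradiction (H⊆ (here refl)) e∉H′ ; (there e∈) → creates e∈ }
  ... | no ¬free₁ with H′ , H⊆ , free′ , creates ← greedy L H free =
    H′ , H⊆ , free′ , λ { (here refl) → creates-e ; (there e∈) → creates e∈ }
    where
    copy : ∃[ i ] proj₂ (𝓕 i) ⊑ addEdge H e ∣e∣≡r e∉H
    copy with any? (λ i → proj₂ (𝓕 i) ⊑? addEdge H e ∣e∣≡r e∉H)
    ... | yes c = c
    ... | no ¬c = contradiction (λ i c → ¬c (i , c)) ¬free₁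
    creates-e : ∀ ∣e∣≡r e∉H′ → ∃[ i ] proj₂ (𝓕 i) ⊑ addEdge H′ e ∣e∣≡r e∉H′
    creates-e ∣e∣≡r′ e∉H′ = proj₁ copy ,
      ⊑-mono {F = proj₂ (𝓕 (proj₁ copy))} {addEdge H e ∣e∣≡r e∉H} {addEdge H′ e ∣e∣≡r′ e∉H′}
        (λ { (here eq) → here eq ; (there e∈) → there (H⊆ e∈) }) (proj₂ copy)

  -- Every member of the family has an edge, so the greedy procedure may start from
  -- the graph without edges.
  saturated-exists : ∀ n → Σ[ H ∈ RGraph r n ] Saturated 𝓕 H
  saturated-exists n with H , _ , free , creates ← greedy (allSubsets n) (mkRGraph [] All.[] AllPairs.[])
                            (λ i (_ , edge) → contradiction (edge _ (proj₂ (nonempty i))) λ ()) =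
    H , free , λ e → creates (∈-allSubsets e)

  sat-exists : ∀ n → ∃[ c ] IsSat 𝓕 n c
  sat-exists n with c , (H , sat , eq) , lower ← least {P = λ c → Σ[ H ∈ RGraph r n ] (Saturated 𝓕 H × e[ H ] ≡ c)}
      (λ c → anyRGraph? (λ H → Saturated 𝓕 H × e[ H ] ≡ c) (λ H → saturated? 𝓕 H ×-dec (e[ H ] ℕₚ.≟ c))
        (λ {H} {H′} H⊆ ⊆H (sat , eq) → Saturated-resp 𝓕 {H = H} {H′} H⊆ ⊆H sat ,
          trans (ℕₚ.≤-antisym (unique-⊆⇒length≤ (unique H′) ⊆H) (unique-⊆⇒length≤ (unique H) H⊆)) eq))
      (_ , proj₁ (saturated-exists n) , proj₂ (saturated-exists n) , refl) =
    c , (H , sat , eq) , λ H′ sat′ → lower _ (H′ , sat′ , refl)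

-- Sequences that oscillate

module _ (x : ℝ) where
  open ℝ x

  upper-closed : ∀ {p q} → Upper p → p ℚ.≤ q → Upper q
  upper-closed {p} {q} Up p≤q with ℚₚ.<-cmp p q
  ... | tri< p<q _ _  = Equivalence.from (upper-rounded q) (p , p<q , Up)
  ... | tri≈ _ refl _ = Up
  ... | tri> _ _ p>q  = contradiction (ℚₚ.<-≤-trans p>q p≤q) (ℚₚ.<-irrefl refl)

-- If a sequence is infinitely often at most ε and infinitely often at least 3 ε,
-- no real number is eventually within ε of all its terms.
oscillation⇒diverges : ∀ (a : Sequence) ε → 0ℚ ℚ.< ε →
  (∀ N → ∃[ n ] (N ≤ suc n × a (suc n) ℚ.≤ ε)) →
  (∀ N → ∃[ n ] (N ≤ suc n × (ε ℚ.+ ε) ℚ.+ ε ℚ.≤ a (suc n))) →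
  ¬ Converges a
oscillation⇒diverges a ε 0<ε small large (x , conv) with N , near ← conv ε 0<ε
  with n , N≤n , a≤ ← small N | n′ , N≤n′ , ≤a ← large N =
  disjoint _ (proj₁ (near (suc n′) N≤n′) , upper-closed x (proj₂ (near (suc n) N≤n)) le)
  where
  open ℝ x
  cancel : ((ε ℚ.+ ε) ℚ.+ ε) ℚ.- ε ≡ ε ℚ.+ ε
  cancel = trans (ℚₚ.+-assoc (ε ℚ.+ ε) ε (ℚ.- ε))
    (trans (cong ((ε ℚ.+ ε) ℚ.+_) (ℚₚ.+-inverseʳ ε)) (ℚₚ.+-identityʳ (ε ℚ.+ ε)))
  le : a (suc n) ℚ.+ ε ℚ.≤ a (suc n′) ℚ.- ε
  le = ℚₚ.≤-trans (ℚₚ.+-monoˡ-≤ ε a≤)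
    (ℚₚ.≤-trans (ℚₚ.≤-reflexive (sym cancel)) (ℚₚ.+-monoˡ-≤ (ℚ.- ε) ≤a))

frac-≤ : ∀ a b c d .{{_ : NonZero b}} .{{_ : NonZero d}} → a * d ≤ c * b → + a ℚ./ b ℚ.≤ + c ℚ./ d
frac-≤ a (suc b) c (suc d) h = ℚₚ.toℚᵘ-cancel-≤
  (ℚᵘₚ.≤-respˡ-≃ (ℚᵘₚ.≃-sym (ℚₚ.toℚᵘ-fromℚᵘ (mkℚᵘ (+ a) b)))
  (ℚᵘₚ.≤-respʳ-≃ (ℚᵘₚ.≃-sym (ℚₚ.toℚᵘ-fromℚᵘ (mkℚᵘ (+ c) d)))
  (*≤* (subst₂ ℤ._≤_ (ℤₚ.pos-* a (suc d)) (ℤₚ.pos-* c (suc b)) (ℤ.+≤+ h)))))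

thrice : ∀ L .{{_ : NonZero L}} → (+ 1 ℚ./ L ℚ.+ + 1 ℚ./ L) ℚ.+ + 1 ℚ./ L ≡ + 3 ℚ./ L
thrice (suc l) = ℚₚ.toℚᵘ-injective
  (ℚᵘₚ.≃-trans (ℚₚ.toℚᵘ-homo-+ (ε ℚ.+ ε) ε)
  (ℚᵘₚ.≃-trans (ℚᵘₚ.+-cong (ℚᵘₚ.≃-trans (ℚₚ.toℚᵘ-homo-+ ε ε) (ℚᵘₚ.+-cong ε≃ ε≃)) ε≃)
  -- The cross-multiplied numerators of both sides, as unnormalised fractions
  (ℚᵘₚ.≃-trans (*≡* (cong +_ (+-*-Solver.solve 1 (λ l → let L = con 1 :+ l in
      con 1 :+ (l :+ (l :+ (l :+ con 0 :* L :+ (con 1 :+ (l :+ con 0 :* L))) :* L :+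
        (con 1 :+ (l :+ l :* L :+ con 0 :* (con 1 :+ (l :+ l :* L))))) :* L) :=
      con 1 :+ (l :+ (l :+ l :* L) :* L :+ con 2 :* (con 1 :+ (l :+ (l :+ l :* L) :* L)))) refl l)))
  (ℚᵘₚ.≃-sym (ℚₚ.toℚᵘ-fromℚᵘ (mkℚᵘ (+ 3) l))))))
  where
  open +-*-Solver
  ε = + 1 ℚ./ suc l
  ε≃ = ℚₚ.toℚᵘ-fromℚᵘ (mkℚᵘ (+ 1) l)

^-distribʳ-* : ∀ d a b → (a * b) ^ d ≡ a ^ d * b ^ d
^-distribʳ-* zero    a b = refl
^-distribʳ-* (suc d) a b = trans (cong (a * b *_) (^-distribʳ-* d a b))
  (+-*-Solver.solve 4 (λ a b x y → (a :* b) :* (x :* y) := (a :* x) :* (b :* y)) refl a b (a ^ d) (b ^ d))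
  where open +-*-Solver

-- The four forbidden r-graphs

-- The uniformity is r = 3 + q. The parameter s only has to exceed (2 + q) q; it sets the
-- order p = r + s of the smaller cliques, and m = p + q that of the larger ones.
-- Two more than P is p, and one more than k is m.
module Construction (q s : ℕ) (q[2+q]<s : (2 + q) * q < s) where

  r P p m k : ℕ
  r = 3 + q
  P = 1 + (q + s)
  p = r + s
  k = 2 + (q + s + q)
  m = suc k

  size : Fin 4 → ℕ
  size 0F = P + (2 + (1 + q))
  size 1F = (r + s) + (2 + q)
  size 2F = (1 + P) + (1 + (1 + P))
  size 3F = r * suc k

  -- The four forbidden graphs: an edge meeting a clique of order p in two vertices;
  -- a sunflower on a clique of order p with 2 + q petals; two cliques of order p
  -- sharing one vertex; an edge with a clique of order m attached at each vertex.
  forbidden : ∀ i → Pattern (size i)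
  forbidden 0F = glue P 2 (1 + q)
  forbidden 1F = sunflower r s (2 + q)
  forbidden 2F = glue (1 + P) 1 (1 + P)
  forbidden 3F = spider r k

  -- The edge set contains none of the four graphs.
  Free : List (Subset n) → Set
  Free es = ∀ i → ¬ Copy r (forbidden i) es

  P+2≡p : P + 2 ≡ p
  P+2≡p = ℕₚ.+-comm P 2

  p≤m : p ≤ m
  p≤m = ℕₚ.m≤m+n p q

  r<p : r < p
  r<p = ≤-trans (≤-reflexive (ℕₚ.+-comm 1 r)) (ℕₚ.+-monoʳ-≤ r (≤-trans (s≤s z≤n) q[2+q]<s))

  r<m : r < m
  r<m = ≤-trans r<p p≤m

  -- Complete subgraphs when the forbidden graphs are absent

  -- X spans a complete subgraph of order a.
  record K (es : List (Subset n)) (a : ℕ) (X : Subset n) : Set where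
    constructor mkK
    field
      ∣X∣≡a  : ∣ X ∣ ≡ a
      clique : Clique r es X

  open K

  K? : ∀ (es : List (Subset n)) a X → Dec (K es a X)
  K? es a X = map′ (λ (h , c) → mkK h c) (λ (mkK h c) → h , c) ((∣ X ∣ ℕₚ.≟ a) ×-dec Clique? r es X)

  oneOrMore : ∀ {A B : Subset n} {x} → x ∈ A → x ∈ B → ∣ A ∩ B ∣ ≡ 1 ⊎ 2 ≤ ∣ A ∩ B ∣
  oneOrMore {A = A} {B} x∈A x∈B with ∣ A ∩ B ∣ | x∈p⇒∣p-x∣<∣p∣ (x∈p∩q⁺ {p = A} {q = B} (x∈A , x∈B))
  ... | suc zero    | _ = inj₁ refl
  ... | suc (suc _) | _ = inj₂ (s≤s (s≤s z≤n))

  module _ {es : List (Subset n)} where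

    -- A complete subgraph of order p meeting an edge in exactly two vertices is a copy of
    -- the first forbidden graph.
    meet2 : ∀ {A e x y} → K es p A → ∣ e ∣ ≡ r → e ∈ₗ es → x ≢ y → A ∩ e ≡ pair x y →
            Copy r (forbidden 0F) es
    meet2 {A} {e} {x} {y} KA ∣e∣ e∈ x≢y A∩e = copy-glue {X = A} {Y = e} (clique KA) (edge⇒Clique ∣e∣ e∈)
      (ℕₚ.+-cancelˡ-≡ 2 _ _ (trans (cong (_+ ∣ A ─ e ∣) (sym two)) (trans (∣p∩q∣+∣p─q∣≡∣p∣ A e) (∣X∣≡a KA))))
      two
      (ℕₚ.+-cancelˡ-≡ 2 _ _ (trans (cong (_+ ∣ e ─ A ∣) (sym (trans (cong ∣_∣ (∩-comm e A)) two)))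
        (trans (∣p∩q∣+∣p─q∣≡∣p∣ e A) ∣e∣)))
      where
      two : ∣ A ∩ e ∣ ≡ 2
      two = trans (cong ∣_∣ A∩e) (∣pair∣≡2 x≢y)

    -- A subset Z of A of prescribed size which meets B in exactly x and y.
    thin : ∀ {A B : Subset n} {x y a} → x ∈ A → y ∈ A → x ∈ B → y ∈ B → x ≢ y →
           2 ≤ a → a ≤ 2 + ∣ A ─ B ∣ → ∃[ Z ] (Z ⊆ A × ∣ Z ∣ ≡ a × Z ∩ B ≡ pair x y)
    thin {A} {B} {x} {y} {a} x∈A y∈A x∈B y∈B x≢y 2≤a a≤ with
      interpolate {X = pair x y} {Y = pair x y ∪ (A ─ B)} (p⊆p∪q _)
        (≤-trans (∣pair∣≤2 x y) 2≤a) (≤-trans a≤ (≤-reflexive (sym size∪)))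
      where
      size∪ : ∣ pair x y ∪ (A ─ B) ∣ ≡ 2 + ∣ A ─ B ∣
      size∪ = trans (∣p∪q∣≡∣p∣+∣q∣ (pair x y) (A ─ B)
                (λ z∈ z∈′ → x∈p─q⇒x∉q A B z∈′ (pair⊆ x∈B y∈B z∈)))
                (cong (_+ ∣ A ─ B ∣) (∣pair∣≡2 x≢y))
    ... | Z , pair⊆Z , Z⊆ , ∣Z∣ = Z , Z⊆A , ∣Z∣ , ⊆-antisym ⊆₁ ⊆₂
      where
      Z⊆A : Z ⊆ A
      Z⊆A z∈ with x∈p∪q⁻ (pair x y) (A ─ B) (Z⊆ z∈)
      ... | inj₁ z∈′ = pair⊆ x∈A y∈A z∈′
      ... | inj₂ z∈′ = p─q⊆p A B z∈′
      ⊆₁ : Z ∩ B ⊆ pair x y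
      ⊆₁ z∈ with z∈Z , z∈B ← x∈p∩q⁻ Z B z∈ with x∈p∪q⁻ (pair x y) (A ─ B) (Z⊆ z∈Z)
      ... | inj₁ z∈′ = z∈′
      ... | inj₂ z∈′ = contradiction z∈B (x∈p─q⇒x∉q A B z∈′)
      ⊆₂ : pair x y ⊆ Z ∩ B
      ⊆₂ z∈ = x∈p∩q⁺ (pair⊆Z z∈ , pair⊆ x∈B y∈B z∈)

    -- The first forbidden graph also arises if an edge has two vertices in a complete
    -- subgraph A of order m without lying inside A: it misses at least p - 2 vertices of
    -- A, and these and the two contain a complete subgraph of order p meeting it in just
    -- the two.
    leavingEdge : ∀ {A e x y z} → K es m A → ∣ e ∣ ≡ r → e ∈ₗ es →
                  x ∈ A → y ∈ A → x ∈ e → y ∈ e → x ≢ y → z ∈ e → z ∉ A →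
                  Copy r (forbidden 0F) es
    leavingEdge {A} {e} {x} {y} {z} KA ∣e∣ e∈ x∈A y∈A x∈e y∈e x≢y z∈e z∉A =
      let Z , Z⊆A , ∣Z∣ , Z∩e = thin {A = A} {B = e} x∈A y∈A x∈e y∈e x≢y (s≤s (s≤s z≤n)) p≤
      in meet2 (mkK ∣Z∣ (Clique-⊆ Z⊆A (clique KA))) ∣e∣ e∈ x≢y Z∩e
      where
      A∩e⊂e : A ∩ e ⊂ e
      A∩e⊂e = p∩q⊆q A e , z , z∈e , λ z∈ → z∉A (proj₁ (x∈p∩q⁻ A e z∈))
      ∣A∩e∣≤ : ∣ A ∩ e ∣ ≤ 2 + q
      ∣A∩e∣≤ = ℕₚ.≤-pred (≤-trans (p⊂q⇒∣p∣<∣q∣ A∩e⊂e) (≤-reflexive ∣e∣))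
      p≤ : p ≤ 2 + ∣ A ─ e ∣
      p≤ = ℕₚ.+-cancelʳ-≤ q p (2 + ∣ A ─ e ∣)
        (≤-trans (≤-reflexive (trans (sym (∣X∣≡a KA)) (sym (∣p∩q∣+∣p─q∣≡∣p∣ A e))))
        (≤-trans (ℕₚ.+-monoˡ-≤ ∣ A ─ e ∣ ∣A∩e∣≤)
        (≤-reflexive (cong (λ z → 2 + z) (ℕₚ.+-comm q ∣ A ─ e ∣)))))

    meet1 : ∀ {A B} → K es p A → K es p B → ∣ A ∩ B ∣ ≡ 1 → Copy r (forbidden 2F) es
    meet1 {A} {B} KA KB one = copy-glue {X = A} {Y = B} (clique KA) (clique KB)
      (ℕₚ.suc-injective (trans (cong (_+ ∣ A ─ B ∣) (sym one)) (trans (∣p∩q∣+∣p─q∣≡∣p∣ A B) (∣X∣≡a KA))))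
      one
      (ℕₚ.suc-injective (trans (cong (_+ ∣ B ─ A ∣) (sym (trans (cong ∣_∣ (∩-comm B A)) one)))
        (trans (∣p∩q∣+∣p─q∣≡∣p∣ B A) (∣X∣≡a KB))))

    module _ (free : Free es) where

      -- Complete subgraphs of order p which share a vertex differ in at most q vertices:
      -- they share a second vertex, and if A had q + 1 vertices outside B, these and the
      -- two shared vertices would form an edge meeting B in exactly two vertices.
      K-p-overlap : ∀ {A B x} → K es p A → K es p B → x ∈ A → x ∈ B → ∣ A ─ B ∣ ≤ q
      K-p-overlap {A} {B} KA KB x∈A x∈B with oneOrMore {A = A} {B} x∈A x∈B
      ... | inj₁ one = contradiction (meet1 KA KB one) (free 2F)
      ... | inj₂ 2≤  with x , y , x∈ , y∈ , x≢y ← twoElements 2≤ = ℕₚ.≮⇒≥ tooMany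
        where
        tooMany : ¬ (q < ∣ A ─ B ∣)
        tooMany q<
          with x∈A , x∈B ← x∈p∩q⁻ A B x∈ | y∈A , y∈B ← x∈p∩q⁻ A B y∈
          with e , e⊆A , ∣e∣ , e∩B ← thin {A = A} {B = B} {a = r} x∈A y∈A x∈B y∈B x≢y (s≤s (s≤s z≤n)) (s≤s (s≤s q<)) =
          free 0F (meet2 KB ∣e∣ (clique KA e ∣e∣ e⊆A) x≢y (trans (∩-comm B e) e∩B))

      -- Complete subgraphs of order m which share a vertex coincide.
      K-m-disjoint : ∀ {A B x} → K es m A → K es m B → x ∈ A → x ∈ B → B ⊆ A
      K-m-disjoint {A} {B} {x} KA KB x∈A x∈B with ⊆⊎⊈ B A
      ... | inj₁ B⊆A = B⊆A
      ... | inj₂ (z , z∈B , z∉A) with oneOrMore {A = A} {B} x∈A x∈B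
      ... | inj₁ one = contradiction (meet1 KA′ KB′ (ℕₚ.≤-antisym ≤1 1≤)) (free 2F)
        where
        shrink : ∀ {X} → K es m X → x ∈ X → ∃[ Z ] (⁅ x ⁆ ⊆ Z × Z ⊆ X × ∣ Z ∣ ≡ p)
        shrink {X} KX x∈X = interpolate (λ y∈ → subst (_∈ X) (sym (x∈⁅y⁆⇒x≡y x y∈)) x∈X)
          (≤-trans (≤-reflexive (∣⁅x⁆∣≡1 x)) (s≤s z≤n)) (≤-trans p≤m (≤-reflexive (sym (∣X∣≡a KX))))
        A′ = proj₁ (shrink KA x∈A)
        B′ = proj₁ (shrink KB x∈B)
        hA = proj₂ (shrink KA x∈A)
        hB = proj₂ (shrink KB x∈B)
        A′⊆A : A′ ⊆ A
        A′⊆A = proj₁ (proj₂ hA)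
        B′⊆B : B′ ⊆ B
        B′⊆B = proj₁ (proj₂ hB)
        KA′ : K es p A′
        KA′ = mkK (proj₂ (proj₂ hA)) (Clique-⊆ A′⊆A (clique KA))
        KB′ : K es p B′
        KB′ = mkK (proj₂ (proj₂ hB)) (Clique-⊆ B′⊆B (clique KB))
        ≤1 : ∣ A′ ∩ B′ ∣ ≤ 1
        ≤1 = ≤-trans (p⊆q⇒∣p∣≤∣q∣ λ y∈ → let y∈A , y∈B = x∈p∩q⁻ A′ B′ y∈ in x∈p∩q⁺ (A′⊆A y∈A , B′⊆B y∈B))
                     (≤-reflexive one)
        1≤ : 1 ≤ ∣ A′ ∩ B′ ∣
        1≤ = ≤-trans (s≤s z≤n) (x∈p⇒∣p-x∣<∣p∣ (x∈p∩q⁺ {p = A′} {q = B′} (proj₁ hA (x∈⁅x⁆ x) , proj₁ hB (x∈⁅x⁆ x))))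
      ... | inj₂ 2≤ with x , y , x∈ , y∈ , x≢y ← twoElements 2≤
                    with x∈A , x∈B ← x∈p∩q⁻ A B x∈ | y∈A , y∈B ← x∈p∩q⁻ A B y∈
                    with e , ⊆e , e⊆B , ∣e∣ ← interpolate {X = insert z (pair x y)} {Y = B}
                           (λ w∈ → [ (λ { refl → z∈B }) , pair⊆ x∈B y∈B ]′ (∈-insert⁻ w∈)) {r}
                           (≤-trans (≤-reflexive (∣insert∣ λ z∈ → z∉A (pair⊆ x∈A y∈A z∈)))
                             (≤-trans (s≤s (∣pair∣≤2 x y)) (s≤s (s≤s (s≤s z≤n)))))
                           (≤-trans (ℕₚ.<⇒≤ r<m) (≤-reflexive (sym (∣X∣≡a KB)))) =
        contradiction (leavingEdge KA ∣e∣ (clique KB e ∣e∣ e⊆B) x∈A y∈A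
            (⊆e (⊆insert z _ (x∈pair x y))) (⊆e (⊆insert z _ (y∈pair x y))) x≢y (⊆e (x∈insert z _)) z∉A)
          (free 0F)

    infix 4 _∼_
    -- Two vertices are related if some complete subgraph of order p contains both.
    -- This need not be transitive.
    _∼_ : Fin n → Fin n → Set
    x ∼ y = ∃[ A ] (K es p A × x ∈ A × y ∈ A)

    ∼-sym : ∀ {x y} → x ∼ y → y ∼ x
    ∼-sym (A , KA , x∈ , y∈) = A , KA , y∈ , x∈

    _∼?_ : ∀ x y → Dec (x ∼ y)
    x ∼? y = anySubset? (λ A → K? es p A ×-dec ((x ∈? A) ×-dec (y ∈? A)))

    -- All vertices related to x, including x if it is in a complete subgraph of order p.
    neighbours : Fin n → Subset n
    neighbours x = subset (x ∼?_)

    module _ (free : Free es) where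

      -- If 2 + q vertices outside A were related to x, the complete subgraphs joining
      -- them to x would each contain all but q vertices of A, hence share r vertices of A,
      -- as s exceeds (2 + q) q. This gives a sunflower.
      outside≤ : ∀ {A x} → K es p A → x ∈ A → ∣ neighbours x ─ A ∣ ≤ 1 + q
      outside≤ {A} {x} KA x∈A = ℕₚ.≮⇒≥ tooMany
        where
        r≤ : ∀ {a} → ∣ A ∣ ≤ a + (2 + q) * q → r ≤ a
        r≤ {a} le = ℕₚ.+-cancelʳ-≤ s r a (≤-trans (≤-reflexive (sym (∣X∣≡a KA)))
          (≤-trans le (ℕₚ.+-monoʳ-≤ a (ℕₚ.<⇒≤ q[2+q]<s))))
        refute : (y : Fin (2 + q) → Fin n) → Inj y → (∀ j → y j ∉ A) → (∀ j → x ∼ y j) → Empty.⊥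
        refute y inj y∉A x∼y
          with I , I⊆A , I⊆B , p≤ ← commonPart (2 + q) (λ j → proj₁ (x∼y j)) A
                 (λ j → let _ , KB , x∈B , _ = x∼y j in K-p-overlap free KA KB x∈A x∈B)
          with C , C⊆I , ∣C∣ ← subsetOfSize I (r≤ p≤) =
          free 1F (copy-sunflower y (clique KA) (∣X∣≡a KA) (λ w∈ → I⊆A (C⊆I w∈)) ∣C∣ inj y∉A grown)
          where
          grown : ∀ j → Clique r es (insert (y j) C)
          grown j with B , KB , _ , y∈B ← x∼y j in eq = Clique-⊆ grow (clique KB)
            where
            C⊆B : C ⊆ B
            C⊆B w∈ = subst (_ ∈_) (cong proj₁ eq) (I⊆B j (C⊆I w∈))
            grow : insert (y j) C ⊆ B
            grow w∈ with ∈-insert⁻ w∈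
            ... | inj₁ refl = y∈B
            ... | inj₂ w∈C  = C⊆B w∈C
        tooMany : ¬ (1 + q < ∣ neighbours x ─ A ∣)
        tooMany q< with Y , Y⊆ , ∣Y∣ ← subsetOfSize (neighbours x ─ A) q< =
          refute to inj (λ j → x∈p─q⇒x∉q (neighbours x) A (Y⊆ (to∈ j)))
            (λ j → ∈-subset⁻ (x ∼?_) (p─q⊆p (neighbours x) A (Y⊆ (to∈ j))))
          where open Enum (enum Y ∣Y∣)

      ∣neighbours∣≤ : ∀ x → ∣ neighbours x ∣ ≤ suc m
      ∣neighbours∣≤ x with anySubset? (λ A → K? es p A ×-dec (x ∈? A))
      ... | yes (A , KA , x∈A) = begin
        ∣ neighbours x ∣                                ≡⟨ ∣p∩q∣+∣p─q∣≡∣p∣ (neighbours x) A ⟨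
        ∣ neighbours x ∩ A ∣ + ∣ neighbours x ─ A ∣     ≤⟨ ℕₚ.+-mono-≤ (∣p∩q∣≤∣q∣ (neighbours x) A) (outside≤ KA x∈A) ⟩
        ∣ A ∣ + (1 + q)                                 ≡⟨ cong (_+ (1 + q)) (∣X∣≡a KA) ⟩
        p + (1 + q)                                     ≡⟨ ℕₚ.+-suc p q ⟩
        suc m                                           ∎
        where open ℕₚ.≤-Reasoning
      ... | no none = ≤-trans (p⊆q⇒∣p∣≤∣q∣ {q = ⊥} (λ y∈ → contradiction (lone y∈) none)) (≤-trans (≤-reflexive (∣⊥∣≡0 n)) z≤n)
        where
        lone : ∀ {y} → y ∈ neighbours x → ∃[ A ] (K es p A × x ∈ A)
        lone y∈ with A , KA , x∈A , _ ← ∈-subset⁻ (x ∼?_) y∈ = A , KA , x∈A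

      module _ {v : Fin n} (bad : ∀ X → K es m X → v ∉ X) {T : Subset n} (v∉T : v ∉ T) (∣T∣ : ∣ T ∣ ≡ 2 + q)
               (indep : ∀ {x y} → x ∈ insert v T → y ∈ insert v T → x ≢ y → ¬ x ∼ y) where

        -- The key step. Suppose v lies in no complete subgraph of order m and no two of the
        -- vertices v and T are related. If T is contained in no edge, then adding the edge
        -- formed by v and T creates no forbidden graph.
        addedEdge-free : (∀ {s} → s ∈ₗ es → ¬ T ⊆ s) → Free (insert v T ∷ es)
        addedEdge-free uncovered = go
          where
          open Tight es v∉T (cong suc ∣T∣) (λ {s} → uncovered {s})
          r<r+1 : r < r + 1
          r<r+1 = ≤-reflexive (ℕₚ.+-comm 1 r)
          r<P+2 : r < P + 2
          r<P+2 = ≤-trans r<p (≤-reflexive (sym P+2≡p))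
          r<1+P+1 : r < (1 + P) + 1
          r<1+P+1 = ≤-trans r<p (≤-reflexive (ℕₚ.+-comm 1 (1 + P)))
          go : ∀ i → ¬ Copy r (forbidden i) (e ∷ es)
          go 0F c with smallPart c 1F refl
          ... | inj₂ core = free 0F (mkCopy (emb c) (emb-inj c) λ { 0F → largePart c 0F r<P+2 ; 1F → core })
          -- The new edge meets a clique of order p in the images x of the two shared vertices.
          ... | inj₁ core≡e = indep (x∈e 0F) (x∈e 1F) x≢y
              (copyOf c 0F , mkK (trans (∣copyOf∣ c 0F) P+2≡p) (largePart c 0F r<P+2) , x∈X 0F , x∈X 1F)
            where
            x : Fin 2 → Fin n
            x i = emb c (P ↑ʳ (i ↑ˡ (1 + q)))
            x≢y : x 0F ≢ x 1F
            x≢y eq with () ← ↑ˡ-injective {m = 2} (1 + q) 0F 1F (↑ʳ-injective P _ _ (emb-inj c eq))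
            x∈e : ∀ i → x i ∈ e
            x∈e i = subst (x i ∈_) core≡e (∈-range⁺ (emb c ∘ part (forbidden 0F) 1F) (i ↑ˡ (1 + q)))
            x∈X : ∀ i → x i ∈ copyOf c 0F
            x∈X i = subst (_∈ copyOf c 0F)
              (cong (emb c) (⊕-ʳ {P} (_↑ˡ (2 + (1 + q))) (λ z → P ↑ʳ (z ↑ˡ (1 + q))) i))
              (∈-range⁺ (emb c ∘ part (forbidden 0F) 0F) (P ↑ʳ i))
          go 1F c = free 1F (tight⇒Copy c λ { zero → r<p ; (suc _) → r<r+1 })
          go 2F c = free 2F (tight⇒Copy c λ { 0F → r<1+P+1 ; 1F → r<p })
          go 3F c with smallPart c 0F refl
          ... | inj₂ core = free 3F (mkCopy (emb c) (emb-inj c) λ { zero → core ; (suc i) → largePart c (suc i) r<m })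
          -- The new edge is the body of the spider, so v lies on a leg, a clique of order m.
          ... | inj₁ core≡e with i , eq ← ∈-range⁻ (emb c ∘ part (forbidden 3F) 0F) (subst (v ∈_) (sym core≡e) (x∈insert v T)) =
            bad (copyOf c (suc i)) (mkK (∣copyOf∣ c (suc i)) (largePart c (suc i) r<m))
              (subst (_∈ copyOf c (suc i)) eq (∈-range⁺ (emb c ∘ part (forbidden 3F) (suc i)) 0F))

  -- The family of these graphs

  𝓕 : Family r 4
  𝓕 i = size i , graph r (forbidden i)

  r≤card : ∀ i j → r ≤ card (forbidden i) j
  r≤card 0F 0F = ≤-trans (ℕₚ.<⇒≤ r<p) (≤-reflexive (sym P+2≡p))
  r≤card 0F 1F = ≤-refl
  r≤card 1F 0F = ℕₚ.<⇒≤ r<p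
  r≤card 1F (suc _) = ℕₚ.m≤m+n r 1
  r≤card 2F 0F = ≤-trans (ℕₚ.<⇒≤ r<p) (≤-reflexive (ℕₚ.+-comm 1 (1 + P)))
  r≤card 2F 1F = ℕₚ.<⇒≤ r<p
  r≤card 3F 0F = ≤-refl
  r≤card 3F (suc _) = ℕₚ.<⇒≤ r<m

  part₀ : ∀ i → Fin (parts (forbidden i))
  part₀ 0F = zero
  part₀ 1F = zero
  part₀ 2F = zero
  part₀ 3F = zero

  hasEdge : ∀ i → ∃[ e ] e ∈ₗ edges (proj₂ (𝓕 i))
  hasEdge i with e , e⊆ , ∣e∣ ← subsetOfSize (range (part (forbidden i) (part₀ i)))
      (≤-trans (r≤card i (part₀ i)) (≤-reflexive (sym (∣range∣ (part-inj (forbidden i) (part₀ i)))))) =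
    e , ∈-graph⁺ r (forbidden i) (∣e∣ , part₀ i , e⊆)

  connected : ∀ i → Connected (forbidden i)
  connected 0F = glue-connected P 1 (1 + q)
  connected 1F = sunflower-connected (2 + q) s (2 + q)
  connected 2F = glue-connected (1 + P) 0 (1 + P)
  connected 3F = spider-connected (2 + q) k

  size-0F : size 0F ≡ suc m
  size-0F = +-*-Solver.solve 2 (λ q s → (con 1 :+ (q :+ s)) :+ (con 2 :+ (con 1 :+ q)) :=
                                         con 4 :+ (q :+ s :+ q)) refl q s
    where open +-*-Solver

  m<size : ∀ i → m < size i
  m<size 0F = ≤-reflexive (sym size-0F)
  m<size 1F = ℕₚ.+-monoʳ-< p (s≤s (ℕₚ.n≤1+n q))
  m<size 2F = ≤-trans (s≤s (≤-reflexive (ℕₚ.+-comm p q))) (ℕₚ.+-monoˡ-< p (s≤s (≤-trans (ℕₚ.m≤m+n q s) (ℕₚ.n≤1+n (q + s)))))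
  m<size 3F = ℕₚ.m<m+n m (s≤s z≤n)

  Free⇒FreeOf : ∀ (H : RGraph r n) → Free (edges H) → FreeOf 𝓕 H
  Free⇒FreeOf H free i c = free i (⊑⇒Copy (forbidden i) H c)

  FreeOf⇒Free : ∀ (H : RGraph r n) → FreeOf 𝓕 H → Free (edges H)
  FreeOf⇒Free H free i c = free i (Copy⇒⊑ (forbidden i) H c)

  -- Many edges if m does not divide n

  module _ {n : ℕ} (H : RGraph r n) (sat : Saturated 𝓕 H) where

    private
      es = edges H
      free : Free es
      free = FreeOf⇒Free H (proj₁ sat)

    -- A vertex in no complete subgraph of order m.
    Bad : Fin n → Set
    Bad v = ¬ (∃[ X ] (K es m X × v ∈ X))

    -- The complete subgraphs of order m are disjoint, so they cannot cover all vertices.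
    someBad : ¬ m ∣ n → ∃ Bad
    someBad m∤n = ¬∀⟶∃¬ n (λ v → ∃[ X ] (K es m X × v ∈ X)) good?
      (λ good → m∤n (subst (m ∣_) (∣⊤∣≡n n)
        (partition⇒∣ k (λ v → proj₁ (good v)) (λ v → proj₂ (proj₂ (good v))) (λ v → ∣X∣≡a (proj₁ (proj₂ (good v))))
          (λ {x} {y} y∈ → same (proj₂ (good x)) (proj₂ (good y)) y∈) ⊤ (λ _ _ → ∈⊤))))
      where
      good? : ∀ v → Dec (∃[ X ] (K es m X × v ∈ X))
      good? v = anySubset? (λ X → K? es m X ×-dec (v ∈? X))
      same : ∀ {x y A B} → K es m A × x ∈ A → K es m B × y ∈ B → y ∈ A → B ≡ A
      same (KA , x∈A) (KB , y∈B) y∈A =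
        ⊆-antisym (K-m-disjoint free KA KB y∈A y∈B) (K-m-disjoint free KB KA y∈B y∈A)

    -- By saturation and addedEdge-free, T lies in an edge.
    covered : ∀ {v} → Bad v → ∀ {T} → v ∉ T → ∣ T ∣ ≡ 2 + q →
              (∀ {x y} → x ∈ insert v T → y ∈ insert v T → x ≢ y → ¬ x ∼ y) →
              ∃[ e ] (e ∈ₗ es × T ⊆ e)
    covered {v} bad {T} v∉T ∣T∣ indep with Any.any? (T ⊆?_) es
    ... | yes any = find any
    ... | no none = contradiction
        (⊑⇒Copy (forbidden i) (addEdge H e ∣e∣≡r e∉H) c)
        (addedEdge-free free (λ X KX v∈X → bad (X , KX , v∈X)) v∉T ∣T∣ indep
          (λ s∈ T⊆s → none (lose s∈ T⊆s)) i)
      where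
      e = insert v T
      ∣e∣≡r : ∣ e ∣ ≡ r
      ∣e∣≡r = trans (∣insert∣ v∉T) (cong suc ∣T∣)
      e∉H : e ∉ₗ es
      e∉H e∈ = none (lose e∈ (⊆insert v T))
      i = proj₁ (proj₂ sat e ∣e∣≡r e∉H)
      c = proj₂ (proj₂ sat e ∣e∣≡r e∉H)

    -- Take an independent set of (2 + q) u vertices that are different from and unrelated
    -- to a bad vertex v, arranged in 2 + q rows of length u. All its transversals are
    -- covered by edges.
    manyEdges : ¬ m ∣ n → ∀ u → suc ((2 + q) * u) * suc (suc m) ≤ n → u ^ (2 + q) ≤ e[ H ] * r ^ (2 + q)
    manyEdges m∤n u n≥ with v , bad ← someBad m∤n
      with x , x∈ , x-inj , x-indep ← independent _∼_ ∼-sym neighbours (λ {x} → ∈-subset⁺ (x ∼?_)) (∣neighbours∣≤ free)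
             ((2 + q) * u) (⊤ ─ insert v (neighbours v))
             (ℕₚ.+-cancelʳ-≤ (suc (suc m)) _ _ (≤-trans (≤-reflexive (ℕₚ.+-comm _ (suc (suc m)))) (≤-trans n≥ (≤-trans (≤-reflexive (sym (∣⊤∣≡n n)))
               (≤-trans (∣p∣≤∣p─q∣+∣q∣ ⊤ (insert v (neighbours v)))
                 (ℕₚ.+-monoʳ-≤ _ (∣closedNbrs∣≤ _∼_ ∼-sym neighbours (λ {x} → ∈-subset⁺ (x ∼?_)) (∣neighbours∣≤ free) v)))))))
      = coverBound es (uniform H) (λ i a → x (combine i a)) (λ i eq → proj₂ (combine-injective i _ i _ (x-inj eq))) cover
      where
      x∉ : ∀ l → x l ∉ insert v (neighbours v)
      x∉ l = x∈p─q⇒x∉q ⊤ (insert v (neighbours v)) (x∈ l)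
      v≢x : ∀ l → v ≢ x l
      v≢x l refl = x∉ l (x∈insert v (neighbours v))
      v≁x : ∀ l → ¬ v ∼ x l
      v≁x l v∼x = x∉ l (⊆insert v _ (∈-subset⁺ (v ∼?_) v∼x))
      module _ (φ : Fin (2 + q) → Fin u) where
        t : Fin (2 + q) → Fin n
        t i = x (combine i (φ i))
        t-inj : Inj t
        t-inj eq = proj₁ (combine-injective _ _ _ _ (x-inj eq))
        v∉T : v ∉ range t
        v∉T v∈ with i , eq ← ∈-range⁻ t v∈ = v≢x _ (sym eq)
        indep : ∀ {y z} → y ∈ insert v (range t) → z ∈ insert v (range t) → y ≢ z → ¬ y ∼ z
        indep y∈ z∈ y≢z with ∈-insert⁻ y∈ | ∈-insert⁻ z∈
        ... | inj₁ refl | inj₁ refl = contradiction refl y≢z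
        ... | inj₁ refl | inj₂ z∈T with i , refl ← ∈-range⁻ t z∈T = v≁x _
        ... | inj₂ y∈T | inj₁ refl with i , refl ← ∈-range⁻ t y∈T = v≁x _ ∘ ∼-sym
        ... | inj₂ y∈T | inj₂ z∈T with i , refl ← ∈-range⁻ t y∈T | j , refl ← ∈-range⁻ t z∈T =
          x-indep (λ eq → y≢z (cong x eq))
        cover : ∃[ e ] (e ∈ₗ es × (∀ i → t i ∈ e))
        cover with e , e∈ , T⊆e ← covered bad v∉T (∣range∣ t-inj) indep = e , e∈ , λ i → T⊆e (∈-range⁺ t i)

  -- Few edges if m divides n

  module _ (j : ℕ) where

    -- The disjoint union of j complete r-graphs of order m.
    U : RGraph r (j * m)
    U = graph r (blocks j m)

    -- The block containing x.
    block : Fin (j * m) → Subset (j * m)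
    block x = range (combine {j} {m} (quotient {j} m x))

    x∈block : ∀ x → x ∈ block x
    x∈block x = subst (_∈ block x) (combine-remQuot {j} m x) (∈-range⁺ (combine {j} {m} (quotient {j} m x)) (remainder {j} m x))

    ∈block⇒quotient : ∀ {x y} → y ∈ block x → quotient {j} m y ≡ quotient {j} m x
    ∈block⇒quotient {x} y∈ with l , refl ← ∈-range⁻ (combine {j} {m} (quotient {j} m x)) y∈ =
      cong proj₁ (remQuot-combine (quotient {j} m x) l)

    block-K : ∀ {es} → (∀ {e} → e ∈ₗ edges U → e ∈ₗ es) → ∀ x → K es m (block x)
    block-K U⊆ x = mkK (∣range∣ (part-inj (blocks j m) (quotient {j} m x)))
      (λ e ∣e∣ e⊆ → U⊆ (∈-graph⁺ r (blocks j m) (∣e∣ , quotient {j} m x , e⊆)))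

    -- A new edge either has two vertices in a block without lying inside it, or meets
    -- every block at most once; in the second case it is the body of a spider.
    U-saturated : Saturated 𝓕 U
    U-saturated = Free⇒FreeOf U (λ i → connected⇒¬Copy r j m (s≤s (s≤s z≤n)) (forbidden i) (connected i) (r≤card i) (m<size i)) , creates
      where
      creates : ∀ e (∣e∣≡r : ∣ e ∣ ≡ r) (e∉U : e ∉ₗ edges U) → ∃[ i ] proj₂ (𝓕 i) ⊑ addEdge U e ∣e∣≡r e∉U
      creates e ∣e∣≡r e∉U
        with any? (λ x → any? (λ y → (x ∈? e) ×-dec ((y ∈? e) ×-dec ((¬? (x Finₚ.≟ y)) ×-dec (y ∈? block x)))))
      ... | yes (x , y , x∈e , y∈e , x≢y , y∈block) with ⊆⊎⊈ e (block x)
      ... | inj₁ e⊆ = contradiction (clique (block-K id x) e ∣e∣≡r e⊆) e∉U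
      ... | inj₂ (z , z∈e , z∉) = 0F , Copy⇒⊑ (forbidden 0F) (addEdge U e ∣e∣≡r e∉U)
        (leavingEdge (block-K there x) ∣e∣≡r (here refl) (x∈block x) y∈block x∈e y∈e x≢y z∈e z∉)
      creates e ∣e∣≡r e∉U | no transversal = 3F , Copy⇒⊑ (forbidden 3F) (addEdge U e ∣e∣≡r e∉U)
        (copy-spider ∣e∣≡r (here refl) block
          (λ {x} _ → x∈block x , ∣X∣≡a (block-K {es = e ∷ edges U} there x) , clique (block-K there x))
          (λ {x} {y} x∈e y∈e x≢y z∈x z∈y → transversal (x , y , x∈e , y∈e , x≢y ,
            subst (λ b → y ∈ range (combine {j} {m} b)) (trans (sym (∈block⇒quotient z∈y)) (∈block⇒quotient z∈x)) (x∈block y))))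

    -- An edge is determined by its block and its position inside that block.
    e[U]≤ : e[ U ] ≤ j * 2 ^ m
    e[U]≤ = ≤-trans (unique-⊆⇒length≤ (unique U) sub)
      (≤-reflexive (trans (length-cartesianProductWith _ (List.allFin j) (allSubsets m))
        (cong₂ _*_ (length-tabulate {n = j} id) (length-allSubsets m))))
      where
      candidates : List (Subset (j * m))
      candidates = List.cartesianProductWith (λ b → image (combine {j} {m} b)) (List.allFin j) (allSubsets m)
      sub : ∀ {e} → e ∈ₗ edges U → e ∈ₗ candidates
      sub {e} e∈ with _ , b , e⊆ ← ∈-graph⁻ r (blocks j m) e∈ =
        subst (_∈ₗ candidates) (image-preimage (combine {j} {m} b) e⊆)
          (∈-cartesianProductWith⁺ (λ b → image (combine {j} {m} b)) (∈-allFin b)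
            (∈-allSubsets (preimage (combine {j} {m} b) e)))

  -- The four graphs are told apart by their numbers of vertices

  size₀<₁ : size 0F < size 1F
  size₀<₁ = ≤-reflexive (trans (cong suc size-0F) (sym (trans (ℕₚ.+-suc p (suc q)) (cong suc (ℕₚ.+-suc p q)))))

  size₁<₂ : size 1F < size 2F
  size₁<₂ = ≤-trans (≤-reflexive (sym (ℕₚ.+-suc p (2 + q))))
    (≤-trans (ℕₚ.+-monoʳ-≤ p (s≤s (s≤s (ℕₚ.m<m+n q (≤-trans (s≤s z≤n) q[2+q]<s))))) (≤-reflexive (ℕₚ.+-comm p (1 + P))))

  size₂<₃ : size 2F < size 3F
  size₂<₃ = ≤-trans (s≤s (ℕₚ.+-mono-≤ (≤-trans (ℕₚ.n≤1+n _) p≤m) p≤m))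
    (≤-trans (≤-reflexive (sym (ℕₚ.+-suc m m))) (ℕₚ.+-monoʳ-≤ m (≤-trans (≤-reflexive (ℕₚ.+-comm 1 m)) (ℕₚ.+-monoʳ-≤ m (s≤s z≤n)))))

  size-mono : ∀ i j → i Fin.< j → size i < size j
  size-mono 0F 1F _ = size₀<₁
  size-mono 0F 2F _ = ℕₚ.<-trans size₀<₁ size₁<₂
  size-mono 0F 3F _ = ℕₚ.<-trans size₀<₁ (ℕₚ.<-trans size₁<₂ size₂<₃)
  size-mono 1F 2F _ = size₁<₂
  size-mono 1F 3F _ = ℕₚ.<-trans size₁<₂ size₂<₃
  size-mono 2F 3F _ = size₂<₃
  size-mono 1F 1F (s≤s ())
  size-mono 2F 1F (s≤s ())
  size-mono 3F 1F (s≤s ())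
  size-mono 2F 2F (s≤s (s≤s ()))
  size-mono 3F 2F (s≤s (s≤s ()))
  size-mono 3F 3F (s≤s (s≤s (s≤s ())))

  𝓕-nonIso : PairwiseNonIsomorphic 𝓕
  𝓕-nonIso i j i≢j (φ , _) with Finₚ.<-cmp i j
  ... | tri< i<j _ _ = ℕₚ.<⇒≢ (size-mono i j i<j) (↔⇒≡ φ)
  ... | tri≈ _ eq _  = i≢j eq
  ... | tri> _ _ j<i = ℕₚ.<⇒≢ (size-mono j i j<i) (sym (↔⇒≡ φ))

  -- The oscillation of the saturation numbers

  module _ (sat : ℕ → ℕ) (sat-isSat : ∀ n → IsSat 𝓕 n (sat n)) where

    d : ℕ
    d = 2 + q

    sat≤ : ∀ j → sat (j * m) ≤ j * 2 ^ m
    sat≤ j = ≤-trans (proj₂ (sat-isSat (j * m)) (U j) (U-saturated j)) (e[U]≤ j)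

    sat≥ : ∀ n u → ¬ m ∣ n → suc (d * u) * suc (suc m) ≤ n → u ^ d ≤ sat n * r ^ d
    sat≥ n u m∤n n≥ with (H , sat-H , eq) , _ ← sat-isSat n =
      subst (λ c → u ^ d ≤ c * r ^ d) eq (manyEdges H sat-H m∤n u n≥)

    -- The orders n = 1 + w u * m are not divisible by m; they are large enough to give
    -- u ^ d edges up to a constant factor, and at most C * u.
    w : ℕ → ℕ
    w u = suc (d * u) * 3

    C M L : ℕ
    C = suc (suc d * 3 * m)
    M = C ^ d * r ^ d
    L = 3 * M

    instance
      M≢0 : NonZero M
      M≢0 = ℕₚ.m*n≢0 (C ^ d) (r ^ d) {{ℕₚ.m^n≢0 C d}} {{ℕₚ.m^n≢0 r d}}
      L≢0 : NonZero L
      L≢0 = ℕₚ.m*n≢0 3 M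

    ε : ℚ
    ε = + 1 ℚ./ L

    0<ε : 0ℚ ℚ.< ε
    0<ε = ℚₚ.positive⁻¹ ε {{ℚₚ.normalize-pos 1 L}}

    -- At n = j * m there are at most j * 2 ^ m edges, whereas n ^ d is at least j ^ 2.
    small : ∀ N → ∃[ n ] (N ≤ suc n × (sat /n^ d) (suc n) ℚ.≤ ε)
    small N = k + j′ * m , ≤-trans (ℕₚ.m≤n+m N (suc (2 ^ m * L))) j≤jm ,
      frac-≤ (sat (j * m)) ((j * m) ^ d) 1 L {{ℕₚ.m^n≢0 (j * m) d}} bound
      where
      j′ = 2 ^ m * L + N
      j = suc j′
      j≤jm : j ≤ j * m
      j≤jm = ℕₚ.m≤m*n j m
      bound : sat (j * m) * L ≤ 1 * (j * m) ^ d
      bound = begin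
        sat (j * m) * L       ≤⟨ ℕₚ.*-monoˡ-≤ L (sat≤ j) ⟩
        j * 2 ^ m * L         ≡⟨ ℕₚ.*-assoc j (2 ^ m) L ⟩
        j * (2 ^ m * L)       ≤⟨ ℕₚ.*-mono-≤ j≤jm (≤-trans (≤-trans (ℕₚ.m≤m+n (2 ^ m * L) N) (ℕₚ.n≤1+n j′)) j≤jm) ⟩
        (j * m) * (j * m)     ≤⟨ ℕₚ.*-monoʳ-≤ (j * m) (ℕₚ.m≤m*n (j * m) ((j * m) ^ q) {{ℕₚ.m^n≢0 (j * m) q}}) ⟩
        (j * m) ^ d           ≡⟨ ℕₚ.*-identityˡ ((j * m) ^ d) ⟨
        1 * (j * m) ^ d       ∎
        where open ℕₚ.≤-Reasoning

    m∤1+wm : ∀ w → ¬ m ∣ suc (w * m)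
    m∤1+wm w m∣ with () ← ∣1⇒≡1 (∣m+n∣m⇒∣n (subst (m ∣_) (ℕₚ.+-comm 1 (w * m)) m∣) (n∣m*n w))

    -- At n = 1 + w u * m, sat n * M is at least n ^ d, that is, sat n / n ^ d is at least 3 ε.
    large : ∀ N → ∃[ n ] (N ≤ suc n × (ε ℚ.+ ε) ℚ.+ ε ℚ.≤ (sat /n^ d) (suc n))
    large N = w u * m , N≤ , ℚₚ.≤-trans (ℚₚ.≤-reflexive (thrice L))
      (frac-≤ 3 L (sat n₁) (n₁ ^ d) {{L≢0}} {{ℕₚ.m^n≢0 n₁ d}} bound)
      where
      u = suc N
      n₁ = suc (w u * m)
      N≤ : N ≤ n₁
      N≤ = ≤-trans (ℕₚ.n≤1+n N) (≤-trans (ℕₚ.m≤m+n u _) (≤-trans (ℕₚ.n≤1+n (d * u)) (≤-trans (ℕₚ.m≤m*n (suc (d * u)) 3)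
        (≤-trans (ℕₚ.m≤m*n (w u) m) (ℕₚ.n≤1+n (w u * m))))))
      n₁≥ : suc (d * u) * suc (suc m) ≤ n₁
      n₁≥ = ≤-trans (ℕₚ.*-monoʳ-≤ (suc (d * u)) {suc (suc m)} {3 * m} 2+m≤3m)
        (≤-trans (≤-reflexive (sym (ℕₚ.*-assoc (suc (d * u)) 3 m))) (ℕₚ.n≤1+n (w u * m)))
        where
        2+m≤3m : 2 + m ≤ 3 * m
        2+m≤3m = ≤-trans (≤-reflexive (ℕₚ.+-comm 2 m)) (ℕₚ.+-monoʳ-≤ m (≤-trans (s≤s (s≤s z≤n)) (ℕₚ.m≤m+n m (m + 0))))
      n₁≤ : n₁ ≤ C * u
      n₁≤ = begin
        suc (suc (d * u) * 3 * m)      ≤⟨ s≤s (ℕₚ.*-monoˡ-≤ m (ℕₚ.*-monoˡ-≤ 3 (s≤s (ℕₚ.m≤n+m (d * u) N)))) ⟩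
        suc (suc d * u * 3 * m)        ≡⟨ cong suc (+-*-Solver.solve 3 (λ d u m → d :* u :* con 3 :* m := d :* con 3 :* m :* u) refl (suc d) u m) ⟩
        1 + suc d * 3 * m * u          ≤⟨ ℕₚ.+-monoˡ-≤ (suc d * 3 * m * u) (s≤s z≤n) ⟩
        C * u                          ∎
        where open ℕₚ.≤-Reasoning
              open +-*-Solver
      n₁^d≤ : n₁ ^ d ≤ sat n₁ * M
      n₁^d≤ = begin
        n₁ ^ d                        ≤⟨ ℕₚ.^-monoˡ-≤ d n₁≤ ⟩
        (C * u) ^ d                   ≡⟨ ^-distribʳ-* d C u ⟩
        C ^ d * u ^ d                 ≤⟨ ℕₚ.*-monoʳ-≤ (C ^ d) (sat≥ n₁ u (m∤1+wm (w u)) n₁≥) ⟩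
        C ^ d * (sat n₁ * r ^ d)      ≡⟨ +-*-Solver.solve 3 (λ c s r → c :* (s :* r) := s :* (c :* r)) refl (C ^ d) (sat n₁) (r ^ d) ⟩
        sat n₁ * M                    ∎
        where open ℕₚ.≤-Reasoning
              open +-*-Solver
      bound : 3 * n₁ ^ d ≤ sat n₁ * L
      bound = ≤-trans (ℕₚ.*-monoʳ-≤ 3 n₁^d≤)
        (≤-reflexive (+-*-Solver.solve 2 (λ s M → con 3 :* (s :* M) := s :* (con 3 :* M)) refl (sat n₁) M))
        where open +-*-Solver

    diverges : ¬ Converges (sat /n^ d)
    diverges = oscillation⇒diverges (sat /n^ d) ε 0<ε small large

theorem4 : ∀ (r : ℕ) → 3 ≤ r →
    Σ[ 𝓕 ∈ Family r 4 ] (PairwiseNonIsomorphic 𝓕 ×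
    (Σ[ sat ∈ (ℕ → ℕ) ] ((∀ n → IsSat 𝓕 n (sat n)) ×
    ¬ Converges (sat /n^ (r ∸ 1)))))
theorem4 (suc (suc (suc q))) (s≤s (s≤s (s≤s z≤n))) =
  𝓕 , 𝓕-nonIso , sat , sat-isSat , diverges sat sat-isSat
  where
  -- The least value allowed for the parameter s.
  open Construction q (suc ((2 + q) * q)) ≤-refl

  sat : ℕ → ℕ
  sat n = proj₁ (sat-exists 𝓕 hasEdge n)

  sat-isSat : ∀ n → IsSat 𝓕 n (sat n)
  sat-isSat n = proj₂ (sat-exists 𝓕 hasEdge n)
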